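{- Let $r\ge1$. Let $\overline{A}(\ell_1,\dots,\ell_r;k,n)$ be the number of overpartitions of $n$ into non-negative parts, each coloured by one of the primary colours $u_1,\dots,u_r$, having exactly $\ell_i$ parts coloured $u_i$ for each $i$ and exactly $k$ non-overlined parts. Let $\overline{B}(\ell_1,\dots,\ell_r;k,n)$ be the number of finite sequences $\lambda_1,\dots,\lambda_s$ of non-negative integers, each coloured by one of $\tilde u_1,\dots,\tilde u_{2^r-1}$ and each possibly overlined, with $\sum\lambda_i=n$, such that for each $i\in\{1,\dots,r\}$ exactly $\ell_i$ parts have $u_i$ among their primary colours, exactly $k$ parts are non-overlined, and for all $1\le i<s$ $$\lambda_i-\lambda_{i+1}\ge w(c(\lambda_{i+1}))+\chi(\overline{\lambda_{i+1}})-1+\delta(c(\lambda_i),c(\lambda_{i+1})),$$ where $c(\lambda)$ is the colour of $\lambda$ and $\chi(\overline{\lambda_{i+1}})=1$ if $\lambda_{i+1}$ is overlined and $0$ otherwise. Then $\overline{A}(\ell_1,\dots,\ell_r;k,n)=\overline{B}(\ell_1,\dots,\ell_r;k,n)$ for all $\ell_1,\dots,\ell_r,k,n\ge0$.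
   Context: An overpartition with coloured parts is a finite multiset of coloured non-negative integers, some of which are overlined, such that for each colour and each integer value at most one part of that colour and value is overlined (non-overlined parts may repeat). Primary colours $u_1<\dots<u_r$. For $i\in\{1,\dots,2^r-1\}$, $\tilde u_i:=u_1^{\epsilon_1(i)}\cdots u_r^{\epsilon_r(i)}$ where $\epsilon_k(i)=1$ if $2^{k-1}$ appears in the binary expansion of $i$ and $0$ otherwise; "$u_j$ is a primary colour of $\tilde u_i$" means $\epsilon_j(i)=1$. For a colour $\tilde u_i$: $v(\tilde u_i)$ (resp. $z(\tilde u_i)$) is the smallest (resp. largest) primary colour appearing in $\tilde u_i$, and $w(\tilde u_i)$ is the number of primary colours appearing in it. $\delta(\tilde u_i,\tilde u_j)=1$ if $z(\tilde u_i)<v(\tilde u_j)$ (in the order $u_1<\dots<u_r$), and $0$ otherwise. -}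

module Defs where

open import Data.Bool.Base using (Bool; true; false; if_then_else_)
import Data.Bool.Properties as Bool
open import Data.Fin.Base as Fin using (Fin; toℕ; fromℕ)
import Data.Fin.Properties as Fin
open import Data.Integer.Base as ℤ using (+_; 1ℤ)
open import Data.List.Base using (List; allFin; filter; length; map)
import Data.List.Extrema as Extrema
open import Data.List.Relation.Binary.Permutation.Propositional using (↭-setoid)
open import Data.List.Relation.Unary.Linked using (Linked)
open import Data.Nat.Base using (ℕ; zero; suc; _∸_; _^_; _≤_)
open import Data.Nat.DivMod using (_/_; _%_)
open import Data.Nat.ListAction using (sum)
import Data.Nat.Properties as ℕ
open import Data.Product.Base using (Σ; _×_; proj₁)
open import Function.Bundles using (Inverse)
open import Level using (0ℓ)
open import Relation.Binary.Bundles using (Setoid)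
import Relation.Binary.Construct.On as On
open import Relation.Binary.PropositionalEquality using (_≡_; setoid)
open import Relation.Nullary.Decidable using (does; _×-dec_)
open import Relation.Unary using (Pred; Decidable)

count : {A : Set} {P : Pred A 0ℓ} → Decidable P → List A → ℕ
count P? xs = length (filter P? xs)

-- The elements of S satisfying P, identified as in S (proofs of P are ignored).
Sub : (S : Setoid 0ℓ 0ℓ) → Pred (Setoid.Carrier S) 0ℓ → Setoid 0ℓ 0ℓ
Sub S P = On.setoid {B = Σ (Setoid.Carrier S) P} S proj₁

_HasCardinality_ : Setoid 0ℓ 0ℓ → ℕ → Set
S HasCardinality N = Inverse S (setoid (Fin N))

-- The element j stands for the primary colour u_{toℕ j + 1}.
Primary : ℕ → Set
Primary r = Fin r

-- The element c stands for the colour ũ_{toℕ c + 1}, so that the indices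
-- range over 1, …, 2^r - 1.
Colour : ℕ → Set
Colour r = Fin (2 ^ r ∸ 1)

index : ∀ {r} → Colour r → ℕ
index c = suc (toℕ c)

-- The binary digit of i of weight 2^j.
bit : ℕ → ℕ → ℕ
bit j i = _/_ i (2 ^ j) {{ℕ.m^n≢0 2 j}} % 2

ε : ∀ {r} → Primary r → Colour r → ℕ
ε {r} j c = bit (toℕ j) (index {r} c)

_IsPrimaryOf_ : ∀ {r} → Primary r → Colour r → Set
_IsPrimaryOf_ {r} j c = ε {r} j c ≡ 1

isPrimaryOf? : ∀ {r} (c : Colour r) → Decidable (λ (j : Primary r) → _IsPrimaryOf_ {r} j c)
isPrimaryOf? {r} c j = ε {r} j c ℕ.≟ 1

primaries : ∀ {r} → Colour r → List (Primary r)
primaries {r} c = filter (isPrimaryOf? {r} c) (allFin r)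

w : ∀ {r} → Colour r → ℕ
w {r} c = length (primaries {r} c)

-- `min` and `max` take a default value besides the list; here it is the
-- greatest, respectively least, element of Fin (suc r), so it does not affect
-- the extremum of the (always nonempty) list of primary colours.
v z : ∀ {r} → Colour r → Primary r
v {zero}  ()
v {suc r} c = Extrema.min (Fin.≤-totalOrder (suc r)) (fromℕ r) (primaries {suc r} c)
z {zero}  ()
z {suc r} c = Extrema.max (Fin.≤-totalOrder (suc r)) Fin.zero (primaries {suc r} c)

δ : ∀ {r} → Colour r → Colour r → ℕ
δ {r} c d = if does (z {r} c Fin.<? v {r} d) then 1 else 0

record Part (C : Set) : Set where
  constructor part
  field
    value     : ℕ
    colour    : C
    overlined : Bool

open Part public

χ : {C : Set} → Part C → ℕ
χ p = if overlined p then 1 else 0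

weight : {C : Set} → List (Part C) → ℕ
weight ps = sum (map value ps)

#nonOverlined : {C : Set} → List (Part C) → ℕ
#nonOverlined = count (λ p → overlined p Bool.≟ false)

#overlined : ∀ {r} → Primary r → ℕ → List (Part (Primary r)) → ℕ
#overlined c m =
  count (λ p → (colour p Fin.≟ c) ×-dec (value p ℕ.≟ m) ×-dec (overlined p Bool.≟ true))

record InA (r : ℕ) (ℓ : Primary r → ℕ) (k n : ℕ) (ps : List (Part (Primary r))) : Set where
  field
    overpartition : ∀ c m → #overlined c m ps ≤ 1
    total         : weight ps ≡ n
    colours       : ∀ i → count (λ p → colour p Fin.≟ i) ps ≡ ℓ i
    nonOverlined  : #nonOverlined ps ≡ k

-- Finite multisets of parts are lists of parts up to permutation.
Ā : (r : ℕ) (ℓ : Primary r → ℕ) (k n : ℕ) → Setoid 0ℓ 0ℓ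
Ā r ℓ k n = Sub (↭-setoid {A = Part (Primary r)}) (InA r ℓ k n)

Gap : ∀ {r} → Part (Colour r) → Part (Colour r) → Set
Gap {r} p q =
  + value p ℤ.- + value q
    ℤ.≥ + w {r} (colour q) ℤ.+ + χ q ℤ.- 1ℤ ℤ.+ + δ {r} (colour p) (colour q)

record InB (r : ℕ) (ℓ : Primary r → ℕ) (k n : ℕ) (ps : List (Part (Colour r))) : Set where
  field
    total        : weight ps ≡ n
    colours      : ∀ i → count (λ p → isPrimaryOf? {r} (colour p) i) ps ≡ ℓ i
    nonOverlined : #nonOverlined ps ≡ k
    gaps         : Linked (Gap {r}) ps

B̄ : (r : ℕ) (ℓ : Primary r → ℕ) (k n : ℕ) → Setoid 0ℓ 0ℓ
B̄ r ℓ k n = Sub (setoid (List (Part (Colour r)))) (InB r ℓ k n)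

{-# OPTIONS --safe #-}

-- Bound the first part p of a B-sequence by value + w + χ + [j ≤ v] ≤ N + 1
-- (colours numbered from 0), and let f_N^j be the generating function of the
-- sequences so bounded. The gap condition says exactly that p′ may follow p iff
-- p′ is bounded with N = value p and j = z(p) + 1. Deleting the least colour of
-- a first part that attains the bound gives, with y marking N,
--     f^{j+1} = f^j + u_j (T f^{j+1} + y f^r),    f^0 = 1 + y f^r,
-- where T = P - y, P = (d + y)Q, Q : y ↦ yq and d marks non-overlined parts.
-- From P y = q y P one gets, for L_x = 1 - xT, L'_x = 1 - x(qP - y) and
-- A_x = 1 - xP, the relations L_x A_{qx} = A_x L'_x and y L'_x = L_x y. Hence,
-- with products over all m,
--     F^j = ∏_{i≥j} ∏ L_{u_i q^m} ∏_{i<j} ∏ L'_{u_i q^m} (1 - y)^{-1}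
-- satisfies the same recurrence with 1 replaced by ∏ (1 - d u_i q^m) (as
-- T 1 = d), so that ∏ (1 - d u_i q^m) f^r = F^r. As N → ∞ the operator L'_x
-- tends to 1 + x, and F^r to ∏ (1 + u_i q^m): f^r tends to the generating
-- function of overpartitions.
module Submission where

open import Defs
open import Algebra.Bundles using (AbelianGroup)
import Algebra.Properties.Group as GroupProperties
open import Data.Bool.Base using (Bool; true; false; if_then_else_)
import Data.Bool.Properties as Bool
open import Data.Empty using (⊥; ⊥-elim)
open import Data.Fin.Base as Fin using (Fin; toℕ; fromℕ; fromℕ<)
import Data.Fin.Properties as Fin
open import Data.Integer.Base as ℤ using (ℤ; 0ℤ; 1ℤ)
import Data.Integer.Properties as ℤ
open import Data.Integer.Tactic.RingSolver using (solve-∀)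
open import Data.List.Base as List using (List; []; _∷_; _++_; allFin; filter; length; map)
import Data.List.Extrema as Extrema
open import Data.List.Membership.Propositional using (_∈_; _∉_)
open import Data.List.Membership.Propositional.Properties using (∈-lookup; ∈-map⁺; ∈-∃++; ∈-++⁻; ∈-++⁺ˡ; ∈-++⁺ʳ)
import Data.List.Properties as List
open import Data.List.Relation.Binary.Permutation.Propositional using (_↭_; prep; swap; ↭-setoid; ↭-sym; ↭-refl)
import Data.List.Relation.Binary.Permutation.Propositional.Properties as ↭
open import Data.List.Relation.Unary.All as All using (All; []; _∷_)
import Data.List.Relation.Unary.All.Properties as All
open import Data.List.Relation.Unary.AllPairs using (AllPairs; []; _∷_)
import Data.List.Relation.Unary.AllPairs.Properties as AllPairs
open import Data.List.Relation.Unary.Any as Any using (Any; here; there; any?)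
import Data.List.Relation.Unary.Any.Properties as Any
open import Data.List.Relation.Unary.Linked using (Linked; []; [-]; _∷_)
open import Data.List.Relation.Unary.Unique.Propositional using (Unique)
open import Data.Nat.Base using (ℕ; zero; suc; pred; _+_; _*_; _^_; _∸_; _≤_; _<_; z≤n; s≤s; s≤s⁻¹; >-nonZero)
open import Data.Nat.Divisibility using (divides-refl)
open import Data.Nat.DivMod using (_/_; _%_; n/1≡n; 0/n≡0; m/n/o≡m/[n*o]; m*n%n≡0; m*n/n≡m; [m+kn]%n≡m%n; +-distrib-/-∣ʳ; m≡m%n+[m/n]*n; m%n<n; m<n*o⇒m/o<n)
import Data.Nat.Properties as ℕ
open import Data.Product.Base using (Σ; ∃-syntax; _×_; _,_; proj₁; proj₂)
open import Data.Sum.Base using (_⊎_; inj₁; inj₂)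
open import Data.Unit.Base using (⊤; tt)
open import Data.Vec.Base as Vec using (Vec; []; _∷_; head; lookup; replicate; tabulate; zipWith)
import Data.Vec.Properties as Vec
open import Function.Base using (_∘_; id)
open import Level using (0ℓ)
open import Relation.Binary.Bundles using (Setoid)
open import Relation.Binary.PropositionalEquality using (_≡_; _≢_; refl; sym; trans; cong; cong₂; subst; subst₂; setoid; module ≡-Reasoning)
import Relation.Binary.Reasoning.Setoid as SetoidReasoning
open import Relation.Nullary using (¬_; Dec; yes; no; does)
open import Relation.Nullary.Decidable using (_×-dec_; ¬?; map′)
open import Relation.Unary using (Pred; Decidable)

-- Exponent vectors and multiplication by monomials

-- Each equation contains f^r, and y and P only commute up to q, so the system is not solved by
-- elimination: a solution F is exhibited and identified by uniqueness. In the form L_x f^(j+1) =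
-- f^j + x y f^r with x = u_j, the shape of F is motivated as follows. Since L_x = A_x + x y, the
-- product to the right of L_x should absorb A_x and return the product of the L; the relation L_x
-- A_(qx) = A_x L′_x does this once the product runs over all x q^m, as A_x tends to 1 for high
-- powers of q. The factor y must then be pulled out of the remaining L, which turns them into L′
-- and completes F^r. The seed 1/(1 - y) = 1 + y/(1 - y) reproduces f^0 = 1 + y f^r up to the action
-- of the L on 1, which is by scalars; these commute with everything, so the system for f is
-- multiplied by them. Truncating modulo q^(n+1) makes all products finite and makes the limit a
-- value attained from some N on; once also N ≥ n + r, the bound on the first part is no restriction
-- for sequences with sum n. The minus sign in T forces coefficients in ℤ, and counts return only in
-- the last step.

infixr 6 _⊕_
_⊕_ : ∀ {m} → Vec ℕ m → Vec ℕ m → Vec ℕ m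
_⊕_ = zipWith _+_

zeros : ∀ {m} → Vec ℕ m
zeros = replicate _ 0

⊕-assoc : ∀ {m} (a b c : Vec ℕ m) → (a ⊕ b) ⊕ c ≡ a ⊕ (b ⊕ c)
⊕-assoc = Vec.zipWith-assoc ℕ.+-assoc

⊕-comm : ∀ {m} (a b : Vec ℕ m) → a ⊕ b ≡ b ⊕ a
⊕-comm = Vec.zipWith-comm ℕ.+-comm

⊕-identityˡ : ∀ {m} (a : Vec ℕ m) → zeros ⊕ a ≡ a
⊕-identityˡ = Vec.zipWith-identityˡ ℕ.+-identityˡ

⊕-identityʳ : ∀ {m} (a : Vec ℕ m) → a ⊕ zeros ≡ a
⊕-identityʳ = Vec.zipWith-identityʳ ℕ.+-identityʳ

⊕-cancelˡ : ∀ {m} (a : Vec ℕ m) {b c} → a ⊕ b ≡ a ⊕ c → b ≡ c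
⊕-cancelˡ []      {[]}    {[]}    _  = refl
⊕-cancelˡ (x ∷ a) {y ∷ b} {z ∷ c} eq =
  cong₂ _∷_ (ℕ.+-cancelˡ-≡ x y z (Vec.∷-injectiveˡ eq)) (⊕-cancelˡ a (Vec.∷-injectiveʳ eq))

degree : ∀ {m} → Vec ℕ m → ℕ
degree = Vec.sum

degree-⊕ : ∀ {m} (a b : Vec ℕ m) → degree (a ⊕ b) ≡ degree a + degree b
degree-⊕ []      []      = refl
degree-⊕ (x ∷ a) (y ∷ b) rewrite degree-⊕ a b = ℕ+-interchange x y (degree a) (degree b)
  where
  ℕ+-interchange : ∀ x y p q → x + y + (p + q) ≡ x + p + (y + q)
  ℕ+-interchange x y p q = begin
    x + y + (p + q)   ≡⟨ ℕ.+-assoc x y (p + q) ⟩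
    x + (y + (p + q)) ≡⟨ cong (x +_) (ℕ.+-assoc y p q) ⟨
    x + (y + p + q)   ≡⟨ cong (λ s → x + (s + q)) (ℕ.+-comm y p) ⟩
    x + (p + y + q)   ≡⟨ cong (x +_) (ℕ.+-assoc p y q) ⟩
    x + (p + (y + q)) ≡⟨ ℕ.+-assoc x p (y + q) ⟨
    x + p + (y + q)   ∎ where open ≡-Reasoning

_-?_ : ∀ {m} (v a : Vec ℕ m) → Dec (∃[ b ] v ≡ a ⊕ b)
[]      -? []      = yes ([] , refl)
(y ∷ v) -? (x ∷ a) with x ℕ.≤? y | v -? a
... | yes x≤y | yes (b , refl) = yes (y ∸ x ∷ b , cong (_∷ a ⊕ b) (sym (ℕ.m+[n∸m]≡n x≤y)))
... | yes _   | no ¬p = no λ { (z ∷ b , eq) → ¬p (b , Vec.∷-injectiveʳ eq) }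
... | no x≰y  | _     = no λ { (z ∷ b , eq) → x≰y (subst (x ≤_) (sym (Vec.∷-injectiveˡ eq)) (ℕ.m≤m+n x z)) }

-- Coefficient at `v` of the monomial with exponent `a` times the series `g`. The zero `o` is a
-- parameter because both counts in ℕ and coefficients in ℤ are shifted; `shift-map` passes from one
-- to the other.
shift : ∀ {m} {A : Set} → A → Vec ℕ m → (Vec ℕ m → A) → Vec ℕ m → A
shift o a g v with v -? a
... | yes (b , _) = g b
... | no _        = o

module _ {m : ℕ} {A : Set} {o : A} where

  shift-yes : ∀ (a : Vec ℕ m) {g : Vec ℕ m → A} {b v} → v ≡ a ⊕ b → shift o a g v ≡ g b
  shift-yes a {g} {b} {v} eq with v -? a
  ... | yes (c , eq′) = cong g (⊕-cancelˡ a (trans (sym eq′) eq))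
  ... | no ¬p = ⊥-elim (¬p (b , eq))

  shift-no : ∀ (a : Vec ℕ m) {g : Vec ℕ m → A} {v} → ¬ (∃[ b ] v ≡ a ⊕ b) → shift o a g v ≡ o
  shift-no a {g} {v} ¬p with v -? a
  ... | yes p = ⊥-elim (¬p p)
  ... | no _  = refl

  shift-cong : ∀ a {g h : Vec ℕ m → A} v → (∀ b → v ≡ a ⊕ b → g b ≡ h b) → shift o a g v ≡ shift o a h v
  shift-cong a v g≡h with v -? a
  ... | yes (b , eq) = g≡h b eq
  ... | no _         = refl

  shift-vanish : ∀ a {g : Vec ℕ m → A} v → (∀ b → v ≡ a ⊕ b → g b ≡ o) → shift o a g v ≡ o
  shift-vanish a v g≡o with v -? a
  ... | yes (b , eq) = g≡o b eq
  ... | no _         = refl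

  shift-⊕ : ∀ a b {g : Vec ℕ m → A} v → shift o (a ⊕ b) g v ≡ shift o a (shift o b g) v
  shift-⊕ a b {g} v with v -? a
  ... | no ¬p = shift-no (a ⊕ b) {g} {v} λ { (c , eq) → ¬p (b ⊕ c , trans eq (⊕-assoc a b c)) }
  ... | yes (v′ , refl) with v′ -? b
  ...   | yes (v″ , refl) = shift-yes (a ⊕ b) {g} {v″} (sym (⊕-assoc a b v″))
  ...   | no ¬p = shift-no (a ⊕ b) {g} λ { (c , eq) → ¬p (c , ⊕-cancelˡ a (trans eq (⊕-assoc a b c))) }

  shift-zeros : ∀ {g : Vec ℕ m → A} v → shift o zeros g v ≡ g v
  shift-zeros {g} v = shift-yes zeros {g} (sym (⊕-identityˡ v))

shift-map : ∀ {m} {A B : Set} (h : A → B) {o} a {g : Vec ℕ m → A} v →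
            h (shift o a g v) ≡ shift (h o) a (h ∘ g) v
shift-map h a v with v -? a
... | yes _ = refl
... | no _  = refl

shift-zip : ∀ {m} {A : Set} {o : A} (_∙_ : A → A → A) → o ∙ o ≡ o → ∀ a {g h : Vec ℕ m → A} v →
            shift o a (λ b → g b ∙ h b) v ≡ shift o a g v ∙ shift o a h v
shift-zip _∙_ oo a v with v -? a
... | yes _ = refl
... | no _  = sym oo

unit : ∀ r → ℕ → Vec ℕ r
unit zero    _       = []
unit (suc r) zero    = 1 ∷ zeros
unit (suc r) (suc j) = 0 ∷ unit r j

degree-unit : ∀ {r j} → j < r → 1 ≤ degree (unit r j)
degree-unit {suc r} {zero}  _         = s≤s z≤n
degree-unit {suc r} {suc j} (s≤s j<r) = degree-unit j<r

-- Exponents of q (the sum of the parts), of d (the non-overlined parts) and of u_0, ..., u_(r-1).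
-- So `head` is the exponent of q, the one truncated at `M`.
Index : ℕ → Set
Index r = Vec ℕ (2 + r)

i+j-j≡i : ∀ i j → i ℤ.+ j ℤ.- j ≡ i
i+j-j≡i = solve-∀

-- The operators S (multiplication by y), Q, P, T and the recurrence they encode

module Operators (r M : ℕ) where

  -- Wrapped in records without η so that the operators below stay folded.
  record V : Set where
    no-eta-equality
    constructor seq
    field at : ℕ → Index r → ℤ
  open V public

  infix 4 _≈_
  infixl 6 _⊞_ _⊟_

  -- Equality modulo q^(M+1).
  record _≈_ (f g : V) : Set where
    constructor mk≈
    field at≈ : ∀ N v → head v ≤ M → at f N v ≡ at g N v
  open _≈_ public

  _⊞_ _⊟_ : V → V → V
  at (f ⊞ g) N v = at f N v ℤ.+ at g N v
  at (f ⊟ g) N v = at f N v ℤ.- at g N v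

  0# : V
  at 0# _ _ = 0ℤ

  ≈-setoid : Setoid 0ℓ 0ℓ
  ≈-setoid = record
    { Carrier = V ; _≈_ = _≈_
    ; isEquivalence = record
      { refl = mk≈ λ _ _ _ → refl
      ; sym = λ p → mk≈ λ N v h → sym (at≈ p N v h)
      ; trans = λ p q → mk≈ λ N v h → trans (at≈ p N v h) (at≈ q N v h) } }

  open Setoid ≈-setoid public using () renaming (refl to ≈-refl; sym to ≈-sym; trans to ≈-trans)
  module ≈-Reasoning = SetoidReasoning ≈-setoid

  ⊞-cong : ∀ {f f′ g g′} → f ≈ f′ → g ≈ g′ → f ⊞ g ≈ f′ ⊞ g′
  ⊞-cong p q = mk≈ λ N v h → cong₂ ℤ._+_ (at≈ p N v h) (at≈ q N v h)

  ⊟-cong : ∀ {f f′ g g′} → f ≈ f′ → g ≈ g′ → f ⊟ g ≈ f′ ⊟ g′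
  ⊟-cong p q = mk≈ λ N v h → cong₂ ℤ._-_ (at≈ p N v h) (at≈ q N v h)

  sh : Index r → V → V
  at (sh a g) N = shift 0ℤ a (at g N)

  S : V → V
  at (S g) zero    _ = 0ℤ
  at (S g) (suc N) v = at g N v

  qpow : ℕ → Index r
  qpow N = N ∷ 0 ∷ zeros

  q d : Index r
  q = qpow 1
  d = 0 ∷ 1 ∷ zeros

  Q : V → V
  at (Q g) N = shift 0ℤ (qpow N) (at g N)

  P T : V → V
  P g = sh d (Q g) ⊞ S (Q g)
  T g = P g ⊟ S g

  -- Additivity only; compatibility with monomial scalars is a separate fact, stated as commutation
  -- with `sh a`.
  record Linear (F : V → V) : Set where
    field
      resp : ∀ {f g} → f ≈ g → F f ≈ F g
      add  : ∀ f g → F (f ⊞ g) ≈ F f ⊞ F g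
      sub  : ∀ f g → F (f ⊟ g) ≈ F f ⊟ F g
  open Linear public

  -- Dividing by a monomial can only lower the exponent of q; hence every shift respects equality
  -- modulo q^(M+1).
  head-⊕ : ∀ a {v b : Index r} → v ≡ a ⊕ b → head v ≤ M → head b ≤ M
  head-⊕ (x ∷ a) {b = y ∷ b} refl h = ℕ.≤-trans (ℕ.m≤n+m y x) h

  sh-linear : ∀ a → Linear (sh a)
  sh-linear a = record
    { resp = λ p → mk≈ λ N v h → shift-cong a v λ b eq → at≈ p N b (head-⊕ a eq h)
    ; add  = λ f g → mk≈ λ N v h → shift-zip ℤ._+_ refl a v
    ; sub  = λ f g → mk≈ λ N v h → shift-zip ℤ._-_ refl a v }

  S-linear : Linear S
  S-linear = record
    { resp = λ p → mk≈ λ { zero v h → refl ; (suc N) v h → at≈ p N v h }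
    ; add  = λ f g → mk≈ λ { zero v h → refl ; (suc N) v h → refl }
    ; sub  = λ f g → mk≈ λ { zero v h → refl ; (suc N) v h → refl } }

  Q-linear : Linear Q
  Q-linear = record
    { resp = λ p → mk≈ λ N v h → shift-cong (qpow N) v λ b eq → at≈ p N b (head-⊕ (qpow N) eq h)
    ; add  = λ f g → mk≈ λ N v h → shift-zip ℤ._+_ refl (qpow N) v
    ; sub  = λ f g → mk≈ λ N v h → shift-zip ℤ._-_ refl (qpow N) v }

  id-linear : Linear id
  id-linear = record { resp = id ; add = λ _ _ → ≈-refl ; sub = λ _ _ → ≈-refl }

  ∘-linear : ∀ {F G} → Linear F → Linear G → Linear (F ∘ G)
  ∘-linear LF LG = record
    { resp = LF .resp ∘ LG .resp
    ; add  = λ f g → ≈-trans (LF .resp (LG .add f g)) (LF .add _ _)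
    ; sub  = λ f g → ≈-trans (LF .resp (LG .sub f g)) (LF .sub _ _) }

  private
    ++-++ : ∀ a b c d → (a ℤ.+ b) ℤ.+ (c ℤ.+ d) ≡ (a ℤ.+ c) ℤ.+ (b ℤ.+ d)
    ++-++ = solve-∀
    +-interchange : ∀ a b c d → (a ℤ.- b) ℤ.+ (c ℤ.- d) ≡ (a ℤ.+ c) ℤ.- (b ℤ.+ d)
    +-interchange = solve-∀
    minus-interchange : ∀ a b c d → (a ℤ.- b) ℤ.- (c ℤ.- d) ≡ (a ℤ.- c) ℤ.- (b ℤ.- d)
    minus-interchange = solve-∀

  ⊞⊞-interchange : ∀ a b c d → (a ⊞ b) ⊞ (c ⊞ d) ≈ (a ⊞ c) ⊞ (b ⊞ d)
  ⊞⊞-interchange a b c d = mk≈ λ N v _ → ++-++ (at a N v) (at b N v) (at c N v) (at d N v)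

  ⊟⊞-interchange : ∀ a b c d → (a ⊟ b) ⊞ (c ⊟ d) ≈ (a ⊞ c) ⊟ (b ⊞ d)
  ⊟⊞-interchange a b c d = mk≈ λ N v _ → +-interchange (at a N v) (at b N v) (at c N v) (at d N v)

  ⊟⊟-interchange : ∀ a b c d → (a ⊟ b) ⊟ (c ⊟ d) ≈ (a ⊟ c) ⊟ (b ⊟ d)
  ⊟⊟-interchange a b c d = mk≈ λ N v _ → minus-interchange (at a N v) (at b N v) (at c N v) (at d N v)

  ⊞-linear : ∀ {F G} → Linear F → Linear G → Linear (λ g → F g ⊞ G g)
  ⊞-linear LF LG = record
    { resp = λ p → ⊞-cong (LF .resp p) (LG .resp p)
    ; add  = λ f g → ≈-trans (⊞-cong (LF .add f g) (LG .add f g)) (⊞⊞-interchange _ _ _ _)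
    ; sub  = λ f g → ≈-trans (⊞-cong (LF .sub f g) (LG .sub f g)) (⊟⊞-interchange _ _ _ _) }

  ⊟-linear : ∀ {F G} → Linear F → Linear G → Linear (λ g → F g ⊟ G g)
  ⊟-linear LF LG = record
    { resp = λ p → ⊟-cong (LF .resp p) (LG .resp p)
    ; add  = λ f g → ≈-trans (⊟-cong (LF .add f g) (LG .add f g)) (≈-sym (⊟⊞-interchange _ _ _ _))
    ; sub  = λ f g → ≈-trans (⊟-cong (LF .sub f g) (LG .sub f g)) (⊟⊟-interchange _ _ _ _) }

  P-linear : Linear P
  P-linear = ⊞-linear (∘-linear (sh-linear d) Q-linear) (∘-linear S-linear Q-linear)

  T-linear : Linear T
  T-linear = ⊟-linear P-linear S-linear

  -- Commutation relations

  Commute : (V → V) → (V → V) → Set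
  Commute F G = ∀ g → F (G g) ≈ G (F g)

  commute-sym : ∀ F G → Commute F G → Commute G F
  commute-sym F G c g = ≈-sym (c g)

  commute-∘ : ∀ {F G H} → Linear G → Commute F G → Commute F H → Commute F (G ∘ H)
  commute-∘ LG fg fh g = ≈-trans (fg _) (LG .resp (fh g))

  commute-⊞ : ∀ {F G H} → Linear F → Commute F G → Commute F H → Commute F (λ g → G g ⊞ H g)
  commute-⊞ LF fg fh g = ≈-trans (LF .add _ _) (⊞-cong (fg g) (fh g))

  commute-⊟ : ∀ {F G H} → Linear F → Commute F G → Commute F H → Commute F (λ g → G g ⊟ H g)
  commute-⊟ LF fg fh g = ≈-trans (LF .sub _ _) (⊟-cong (fg g) (fh g))

  commute-id : ∀ {F} → Commute F id
  commute-id g = ≈-refl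

  shift-comm : ∀ a b {g : Index r → ℤ} v → shift 0ℤ a (shift 0ℤ b g) v ≡ shift 0ℤ b (shift 0ℤ a g) v
  shift-comm a b {g} v = begin
    shift 0ℤ a (shift 0ℤ b g) v ≡⟨ shift-⊕ a b v ⟨
    shift 0ℤ (a ⊕ b) g v        ≡⟨ cong (λ c → shift 0ℤ c g v) (⊕-comm a b) ⟩
    shift 0ℤ (b ⊕ a) g v        ≡⟨ shift-⊕ b a v ⟩
    shift 0ℤ b (shift 0ℤ a g) v ∎ where open ≡-Reasoning

  sh-sh : ∀ a b → Commute (sh a) (sh b)
  sh-sh a b g = mk≈ λ N v _ → shift-comm a b v

  sh-S : ∀ a → Commute (sh a) S
  sh-S a g = mk≈ λ { zero v _ → shift-vanish a v (λ _ _ → refl) ; (suc N) v _ → refl }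

  sh-Q : ∀ a → Commute (sh a) Q
  sh-Q a g = mk≈ λ N v _ → shift-comm a (qpow N) v

  sh-P : ∀ a → Commute (sh a) P
  sh-P a = commute-⊞ (sh-linear a) (commute-∘ (sh-linear d) (sh-sh a d) (sh-Q a))
                                   (commute-∘ S-linear (sh-S a) (sh-Q a))

  sh-T : ∀ a → Commute (sh a) T
  sh-T a = commute-⊟ (sh-linear a) (sh-P a) (sh-S a)

  Q-S : ∀ g → Q (S g) ≈ sh q (S (Q g))
  Q-S g = mk≈ λ
    { zero v _ → trans (shift-vanish (qpow 0) v λ _ _ → refl) (sym (shift-vanish q v λ _ _ → refl))
    ; (suc N) v _ → trans (cong (λ z → shift 0ℤ (suc N ∷ 0 ∷ z) (at g N) v) (sym (⊕-identityˡ zeros)))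
                          (shift-⊕ q (qpow N) v) }

  -- The source of all exchange relations below. The factor d + y commutes with y, so the q comes
  -- from `Q-S` alone, where `S` raises N by one and `Q` charges q for each unit of N.
  P-S : ∀ g → P (S g) ≈ sh q (S (P g))
  P-S g = begin
    sh d (Q (S g)) ⊞ S (Q (S g))
      ≈⟨ ⊞-cong (sh-linear d .resp (Q-S g)) (S-linear .resp (Q-S g)) ⟩
    sh d (sh q (S (Q g))) ⊞ S (sh q (S (Q g)))
      ≈⟨ ⊞-cong (≈-trans (sh-sh d q _) (sh-linear q .resp (sh-S d _))) (≈-sym (sh-S q _)) ⟩
    sh q (S (sh d (Q g))) ⊞ sh q (S (S (Q g)))
      ≈⟨ sh-linear q .add _ _ ⟨
    sh q (S (sh d (Q g)) ⊞ S (S (Q g)))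
      ≈⟨ sh-linear q .resp (S-linear .add _ _) ⟨
    sh q (S (P g)) ∎ where open ≈-Reasoning

  -- `D x` and `E x` are the scalars 1 - d x and 1 + x: a pair of a colour and a value with monomial
  -- x contributes E/D to the generating function of overpartitions. In `L′` the operator T is
  -- replaced by qP - y, chosen so that y (qP - y) = P y - y y = T y.
  A L L′ D E : Index r → V → V
  A  x g = g ⊟ sh x (P g)
  L  x g = g ⊟ sh x (T g)
  L′ x g = g ⊟ sh x (sh q (P g) ⊟ S g)
  D  x g = g ⊟ sh (d ⊕ x) g
  E  x g = g ⊞ sh x g

  A-linear : ∀ x → Linear (A x)
  A-linear x = ⊟-linear id-linear (∘-linear (sh-linear x) P-linear)

  L-linear : ∀ x → Linear (L x)
  L-linear x = ⊟-linear id-linear (∘-linear (sh-linear x) T-linear)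

  D-linear : ∀ x → Linear (D x)
  D-linear x = ⊟-linear id-linear (sh-linear (d ⊕ x))

  E-linear : ∀ x → Linear (E x)
  E-linear x = ⊞-linear id-linear (sh-linear x)

  sh-A : ∀ a x → Commute (sh a) (A x)
  sh-A a x = commute-⊟ (sh-linear a) commute-id (commute-∘ (sh-linear x) (sh-sh a x) (sh-P a))

  sh-L : ∀ a x → Commute (sh a) (L x)
  sh-L a x = commute-⊟ (sh-linear a) commute-id (commute-∘ (sh-linear x) (sh-sh a x) (sh-T a))

  L-commute : ∀ {F} x → Linear F → Commute F (sh x) → Commute F T → Commute F (L x)
  L-commute x LF fx fT = commute-⊟ LF commute-id (commute-∘ (sh-linear x) fx fT)

  -- Both are polynomials in the single operator T with monomial coefficients.
  L-L : ∀ x y → Commute (L x) (L y)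
  L-L x y = L-commute y (L-linear x) (commute-sym (sh y) (L x) (sh-L y x))
    (commute-sym T (L x) (L-commute x T-linear (commute-sym (sh x) T (sh-T x)) λ _ → ≈-refl))

  D-commute : ∀ {F} x → Linear F → (∀ a → Commute F (sh a)) → Commute F (D x)
  D-commute x LF fs = commute-⊟ LF commute-id (fs (d ⊕ x))

  private
    a-[b-c] : ∀ a b c → a ℤ.- (b ℤ.- c) ≡ a ℤ.- b ℤ.+ c
    a-[b-c] = solve-∀

  ⊟-⊟ : ∀ a b c → a ⊟ (b ⊟ c) ≈ a ⊟ b ⊞ c
  ⊟-⊟ a b c = mk≈ λ N v _ → a-[b-c] (at a N v) (at b N v) (at c N v)

  sh-⊕ : ∀ a b g → sh (a ⊕ b) g ≈ sh a (sh b g)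
  sh-⊕ a b g = mk≈ λ N v _ → shift-⊕ a b v

  L≈A : ∀ x g → L x g ≈ A x g ⊞ sh x (S g)
  L≈A x g = ≈-trans (⊟-cong ≈-refl (sh-linear x .sub _ _)) (⊟-⊟ _ _ _)

  -- Compare `L≈A`: the summand x y is the same, and only the argument of A moves from x to q x.
  -- Both exchange relations `L-A` and `S-L′` rest on this.
  L′≈A : ∀ x g → L′ x g ≈ A (q ⊕ x) g ⊞ sh x (S g)
  L′≈A x g = begin
    g ⊟ sh x (sh q (P g) ⊟ S g)          ≈⟨ ⊟-cong ≈-refl (sh-linear x .sub _ _) ⟩
    g ⊟ (sh x (sh q (P g)) ⊟ sh x (S g)) ≈⟨ ⊟-⊟ _ _ _ ⟩
    g ⊟ sh x (sh q (P g)) ⊞ sh x (S g)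
      ≈⟨ ⊞-cong (⊟-cong ≈-refl (≈-trans (sh-sh x q _) (≈-sym (sh-⊕ q x _)))) ≈-refl ⟩
    A (q ⊕ x) g ⊞ sh x (S g)             ∎ where open ≈-Reasoning

  S-A : ∀ x g → S (A (q ⊕ x) g) ≈ A x (S g)
  S-A x g = begin
    S (A (q ⊕ x) g)                 ≈⟨ S-linear .sub _ _ ⟩
    S g ⊟ S (sh (q ⊕ x) (P g))      ≈⟨ ⊟-cong ≈-refl (sh-S (q ⊕ x) _) ⟨
    S g ⊟ sh (q ⊕ x) (S (P g))      ≈⟨ ⊟-cong ≈-refl (≈-trans (sh-⊕ q x _) (sh-sh q x _)) ⟩
    S g ⊟ sh x (sh q (S (P g)))     ≈⟨ ⊟-cong ≈-refl (sh-linear x .resp (P-S g)) ⟨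
    A x (S g)                       ∎ where open ≈-Reasoning

  -- Both sides equal A_x A_(qx) + x A_x y: on the left y passes A_(qx) by `S-A`, on the right it is
  -- already in place.
  L-A : ∀ x g → L x (A (q ⊕ x) g) ≈ A x (L′ x g)
  L-A x g = begin
    L x h                           ≈⟨ L≈A x h ⟩
    A x h ⊞ sh x (S h)              ≈⟨ ⊞-cong ≈-refl (sh-linear x .resp (S-A x g)) ⟩
    A x h ⊞ sh x (A x (S g))        ≈⟨ ⊞-cong ≈-refl (sh-A x x _) ⟩
    A x h ⊞ A x (sh x (S g))        ≈⟨ A-linear x .add _ _ ⟨
    A x (h ⊞ sh x (S g))            ≈⟨ A-linear x .resp (L′≈A x g) ⟨
    A x (L′ x g)                    ∎
    where
    open ≈-Reasoning
    h = A (q ⊕ x) g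

  S-L′ : ∀ x g → S (L′ x g) ≈ L x (S g)
  S-L′ x g = begin
    S (L′ x g)                           ≈⟨ S-linear .resp (L′≈A x g) ⟩
    S (A (q ⊕ x) g ⊞ sh x (S g))         ≈⟨ S-linear .add _ _ ⟩
    S (A (q ⊕ x) g) ⊞ S (sh x (S g))     ≈⟨ ⊞-cong (S-A x g) (≈-sym (sh-S x _)) ⟩
    A x (S g) ⊞ sh x (S (S g))           ≈⟨ L≈A x (S g) ⟨
    L x (S g)                            ∎ where open ≈-Reasoning

  -- Products over colours and values, and the solution F

  prod : (Index r → V → V) → List (Index r) → V → V
  prod O []       g = g
  prod O (x ∷ xs) g = O x (prod O xs g)

  prod-linear : ∀ {O} → (∀ x → Linear (O x)) → ∀ xs → Linear (prod O xs)
  prod-linear LO []       = id-linear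
  prod-linear LO (x ∷ xs) = ∘-linear (LO x) (prod-linear LO xs)

  prod-commute : ∀ {F O} → (∀ x → Linear (O x)) → (∀ x → Commute F (O x)) → ∀ xs → Commute F (prod O xs)
  prod-commute LO c []       g = ≈-refl
  prod-commute LO c (x ∷ xs) g = ≈-trans (c x _) (LO x .resp (prod-commute LO c xs g))

  prod-++ : ∀ O xs ys g → prod O (xs ++ ys) g ≡ prod O xs (prod O ys g)
  prod-++ O []       ys g = refl
  prod-++ O (x ∷ xs) ys g = cong (O x) (prod-++ O xs ys g)

  S-prod : ∀ xs g → S (prod L′ xs g) ≈ prod L xs (S g)
  S-prod []       g = ≈-refl
  S-prod (x ∷ xs) g = ≈-trans (S-L′ x _) (L-linear x .resp (S-prod xs g))

  slot : ℕ → ℕ → Index r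
  slot j m = m ∷ 0 ∷ unit r j

  q⊕slot : ∀ j m → q ⊕ slot j m ≡ slot j (suc m)
  q⊕slot j m = cong (λ z → suc m ∷ 0 ∷ z) (⊕-identityˡ (unit r j))

  slotsFrom : ℕ → ℕ → ℕ → List (Index r)
  slotsFrom j m zero    = []
  slotsFrom j m (suc c) = slot j m ∷ slotsFrom j (suc m) c

  -- Factors at u_j q^m with m > M are the identity modulo q^(M+1), so these M + 1 monomials stand
  -- for the product over all m.
  slots : ℕ → List (Index r)
  slots j = slotsFrom j 0 (suc M)

  allSlots : ℕ → List (Index r)
  allSlots zero    = []
  allSlots (suc j) = slots j ++ allSlots j

  -- A factor `A` entering from the right moves to the left end by `L-A`: each passage turns one L
  -- into L′ and lowers the exponent of q in the argument by one.
  telescope : ∀ j m c g → prod L (slotsFrom j m c) (A (slot j (c + m)) g) ≈ A (slot j m) (prod L′ (slotsFrom j m c) g)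
  telescope j m zero    g = ≈-refl
  telescope j m (suc c) g = begin
    L x (prod L (slotsFrom j (suc m) c) (A (slot j (suc (c + m))) g))
      ≡⟨ cong (λ k → L x (prod L (slotsFrom j (suc m) c) (A (slot j k) g))) (ℕ.+-suc c m) ⟨
    L x (prod L (slotsFrom j (suc m) c) (A (slot j (c + suc m)) g))
      ≈⟨ L-linear x .resp (telescope j (suc m) c g) ⟩
    L x (A (slot j (suc m)) (prod L′ (slotsFrom j (suc m) c) g))
      ≡⟨ cong (λ y → L x (A y (prod L′ (slotsFrom j (suc m) c) g))) (q⊕slot j m) ⟨
    L x (A (q ⊕ x) (prod L′ (slotsFrom j (suc m) c) g))
      ≈⟨ L-A x _ ⟩
    A x (L′ x (prod L′ (slotsFrom j (suc m) c) g)) ∎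
    where
    open ≈-Reasoning
    x = slot j m

  A-truncated : ∀ j c g → M < c → A (slot j c) g ≈ g
  A-truncated j c g M<c = mk≈ λ N v h → trans
    (cong (ℤ._-_ (at g N v)) (shift-vanish (slot j c) v λ b eq → ⊥-elim (too-big b eq h))) (ℤ.+-identityʳ _)
    where
    too-big : ∀ b {v} → v ≡ slot j c ⊕ b → ¬ (head v ≤ M)
    too-big (y ∷ b) refl h = ℕ.<-irrefl refl (ℕ.<-≤-trans M<c (ℕ.≤-trans (ℕ.m≤m+n c y) h))

  X X′ : ℕ → V → V
  X  j = prod L  (slots j)
  X′ j = prod L′ (slots j)

  -- Write L_x = A_x + x y. By `telescope`, A_x in front of X′ becomes an `A` behind X with argument
  -- u_j q^(M+1), which is 1 modulo q^(M+1). The result has the shape of one step of the recurrence.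
  L-X′ : ∀ j g → L (slot j 0) (X′ j g) ≈ X j g ⊞ sh (slot j 0) (S (X′ j g))
  L-X′ j g = ≈-trans (L≈A _ _) (⊞-cong (begin
    A (slot j 0) (X′ j g)                ≈⟨ telescope j 0 (suc M) g ⟨
    X j (A (slot j (suc M + 0)) g)       ≈⟨ prod-linear L-linear (slots j) .resp (A-truncated j _ g (ℕ.m≤m+n (suc M) 0)) ⟩
    X j g                                ∎) ≈-refl)
    where open ≈-Reasoning

  one : Index r → ℤ
  one v with Vec.≡-dec ℕ._≟_ v zeros
  ... | yes _ = 1ℤ
  ... | no _  = 0ℤ

  -- The sequences 1/(1-y) and 1 when N is marked by y.
  I e : V
  at I N v = one v
  at e zero    v = one v
  at e (suc N) v = 0ℤ

  low : ℕ → V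
  low zero    = I
  low (suc j) = X′ j (low j)

  -- Factors are applied in order of increasing index, as in `low`, so that `high′` continues
  -- `low j` to `low (t + j)`. Pulling y out of `high` turns it into `high′`.
  high high′ : ℕ → ℕ → V → V
  high zero    j g = g
  high (suc t) j g = high t (suc j) (X j g)
  high′ zero    j g = g
  high′ (suc t) j g = high′ t (suc j) (X′ j g)

  high-linear : ∀ t j → Linear (high t j)
  high-linear zero    j = id-linear
  high-linear (suc t) j = ∘-linear (high-linear t (suc j)) (prod-linear L-linear (slots j))

  high-commute : ∀ {F} → (∀ x → Commute F (L x)) → ∀ t j → Commute F (high t j)
  high-commute c zero    j g = ≈-refl
  high-commute c (suc t) j g = ≈-trans (high-commute c t (suc j) _)
    (high-linear t (suc j) .resp (prod-commute L-linear c (slots j) g))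

  S-high : ∀ t j g → S (high′ t j g) ≈ high t j (S g)
  S-high zero    j g = ≈-refl
  S-high (suc t) j g = ≈-trans (S-high t (suc j) _) (high-linear t (suc j) .resp (S-prod (slots j) g))

  high′-low : ∀ t j → high′ t j (low j) ≡ low (t + j)
  high′-low zero    j = refl
  high′-low (suc t) j = trans (high′-low t (suc j)) (cong low (ℕ.+-suc t j))

  F : ℕ → V
  F j = high (r ∸ j) j (low j)

  -- L_x commutes with the factors of index above j, so it meets X′_j, where `L-X′` splits it. In
  -- the second summand y is pulled out to the left, which turns the remaining L into L′ and so
  -- produces all of F^r.
  F-step : ∀ {j} → j < r → L (slot j 0) (F (suc j)) ≈ F j ⊞ sh (slot j 0) (S (F r))
  F-step {j} j<r = begin
    L x (high t (suc j) (X′ j (low j)))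
      ≈⟨ high-commute (L-L x) t (suc j) _ ⟩
    high t (suc j) (L x (X′ j (low j)))
      ≈⟨ high-linear t (suc j) .resp (L-X′ j (low j)) ⟩
    high t (suc j) (X j (low j) ⊞ sh x (S (low (suc j))))
      ≈⟨ high-linear t (suc j) .add _ _ ⟩
    high (suc t) j (low j) ⊞ high t (suc j) (sh x (S (low (suc j))))
      ≈⟨ ⊞-cong ≈-refl (high-commute (sh-L x) t (suc j) _) ⟨
    high (suc t) j (low j) ⊞ sh x (high t (suc j) (S (low (suc j))))
      ≈⟨ ⊞-cong ≈-refl (sh-linear x .resp (S-high t (suc j) _)) ⟨
    high (suc t) j (low j) ⊞ sh x (S (high′ t (suc j) (low (suc j))))
      ≡⟨ cong₂ (λ t′ h → high t′ j (low j) ⊞ sh x (S h)) (sym (ℕ.+-∸-assoc 1 j<r)) eq ⟩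
    F j ⊞ sh x (S (F r)) ∎
    where
    open ≈-Reasoning
    t = r ∸ suc j
    x = slot j 0
    eq : high′ t (suc j) (low (suc j)) ≡ F r
    eq = trans (high′-low t (suc j)) (trans (cong low (ℕ.m∸n+n≡m j<r))
           (cong (λ t → high t r (low r)) (sym (ℕ.n∸n≡0 r))))

  -- The initial value of F and the denominators

  Den : V → V
  Den = prod D (allSlots r)

  Den-linear : Linear Den
  Den-linear = prod-linear D-linear (allSlots r)

  Den-commute : ∀ {F} → Linear F → (∀ a → Commute F (sh a)) → Commute F Den
  Den-commute LF c = prod-commute D-linear (λ x → D-commute x LF c) (allSlots r)

  F-last : F r ≡ low r
  F-last = cong (λ t → high t r (low r)) (ℕ.n∸n≡0 r)

  low≡prod : ∀ j → low j ≡ prod L′ (allSlots j) I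
  low≡prod zero    = refl
  low≡prod (suc j) = trans (cong (X′ j) (low≡prod j)) (sym (prod-++ L′ (slots j) (allSlots j) I))

  I≈e⊞SI : I ≈ e ⊞ S I
  I≈e⊞SI = mk≈ λ { zero v _ → sym (ℤ.+-identityʳ _) ; (suc N) v _ → sym (ℤ.+-identityˡ _) }

  Q-e : Q e ≈ e
  Q-e = mk≈ λ { zero v _ → shift-zeros v ; (suc N) v _ → shift-vanish (qpow (suc N)) v λ _ _ → refl }

  T-e : T e ≈ sh d e
  T-e = ≈-trans (⊟-cong (⊞-cong (sh-linear d .resp Q-e) (S-linear .resp Q-e)) ≈-refl)
    (mk≈ λ N v _ → i+j-j≡i (at (sh d e) N v) (at (S e) N v))

  -- A common eigenvector of all L_x, with eigenvalue the scalar 1 - d x. For `e` this is `T-e`,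
  -- where the y contained in P cancels.
  Eigen : V → Set
  Eigen h = ∀ x → L x h ≈ D x h

  eigen-e : Eigen e
  eigen-e x = ⊟-cong ≈-refl
    (≈-trans (sh-linear x .resp T-e) (≈-trans (sh-sh x d e) (≈-sym (sh-⊕ d x e))))

  L-sh : ∀ x a → Commute (L x) (sh a)
  L-sh x a = commute-sym (sh a) (L x) (sh-L a x)

  D-sh : ∀ x a → Commute (D x) (sh a)
  D-sh x a = commute-sym (sh a) (D x) (D-commute x (sh-linear a) (λ b → sh-sh a b))

  eigen-D : ∀ {h} y → Eigen h → Eigen (D y h)
  eigen-D {h} y eig x = begin
    L x (D y h) ≈⟨ D-commute y (L-linear x) (L-sh x) h ⟩
    D y (L x h) ≈⟨ D-linear y .resp (eig x) ⟩
    D y (D x h) ≈⟨ D-commute x (D-linear y) (D-sh y) h ⟩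
    D x (D y h) ∎ where open ≈-Reasoning

  prod-eigen : ∀ {h} xs → Eigen h → prod L xs h ≈ prod D xs h × Eigen (prod D xs h)
  prod-eigen []       eig = ≈-refl , eig
  prod-eigen (x ∷ xs) eig =
    let eq , eig′ = prod-eigen xs eig in
    ≈-trans (L-linear x .resp eq) (eig′ x) , eigen-D x eig′

  high-e : ∀ t j → high t j (prod D (allSlots j) e) ≈ prod D (allSlots (t + j)) e
  high-e zero    j = ≈-refl
  high-e (suc t) j = begin
    high t (suc j) (X j (prod D (allSlots j) e))
      ≈⟨ high-linear t (suc j) .resp (proj₁ (prod-eigen (slots j) (proj₂ (prod-eigen (allSlots j) eigen-e)))) ⟩
    high t (suc j) (prod D (slots j) (prod D (allSlots j) e))
      ≡⟨ cong (high t (suc j)) (prod-++ D (slots j) (allSlots j) e) ⟨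
    high t (suc j) (prod D (allSlots (suc j)) e)
      ≈⟨ high-e t (suc j) ⟩
    prod D (allSlots (t + suc j)) e
      ≡⟨ cong (λ k → prod D (allSlots k) e) (ℕ.+-suc t j) ⟩
    prod D (allSlots (suc t + j)) e ∎ where open ≈-Reasoning

  -- All factors of F^0 are L's. Split 1/(1 - y) as 1 + y/(1 - y): on 1 they act as scalars and give
  -- `Den e`; pulling y out of the other summand gives y F^r.
  F-zero : F 0 ≈ Den e ⊞ S (F r)
  F-zero = begin
    high r 0 I                      ≈⟨ high-linear r 0 .resp I≈e⊞SI ⟩
    high r 0 (e ⊞ S I)              ≈⟨ high-linear r 0 .add e (S I) ⟩
    high r 0 e ⊞ high r 0 (S I)     ≈⟨ ⊞-cong (high-e r 0) (≈-sym (S-high r 0 I)) ⟩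
    prod D (allSlots (r + 0)) e ⊞ S (high′ r 0 I)
      ≡⟨ cong₂ (λ k h → prod D (allSlots k) e ⊞ S h) (ℕ.+-identityʳ r)
           (trans (high′-low r 0) (trans (cong low (ℕ.+-identityʳ r)) (sym F-last))) ⟩
    Den e ⊞ S (F r)                 ∎ where open ≈-Reasoning

  -- The system satisfied both by the numbers of sequences and, after
  -- multiplication by Den, by F.
  record Solves (c : V) (G : ℕ → V) : Set where
    field
      base : G 0 ≈ c ⊞ S (G r)
      next  : ∀ {j} → j < r → G (suc j) ≈ G j ⊞ sh (slot j 0) (T (G (suc j)) ⊞ S (G r))
  open Solves public

  private
    move : ∀ {f g h k} → f ⊟ g ≈ h ⊞ k → f ≈ h ⊞ (g ⊞ k)
    move {f} {g} {h} {k} p = mk≈ λ N v hd →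
      trans (lemma₁ (at f N v) (at g N v)) (trans (cong (ℤ._+ at g N v) (at≈ p N v hd))
        (lemma₂ (at h N v) (at k N v) (at g N v)))
      where
      lemma₁ : ∀ a b → a ≡ a ℤ.- b ℤ.+ b
      lemma₁ = solve-∀
      lemma₂ : ∀ a b c → a ℤ.+ b ℤ.+ c ≡ a ℤ.+ (c ℤ.+ b)
      lemma₂ = solve-∀

  F-solves : Solves (Den e) F
  F-solves = record
    { base = F-zero
    ; next  = λ {j} j<r → ≈-trans (move (F-step j<r)) (⊞-cong ≈-refl (≈-sym (sh-linear (slot j 0) .add _ _))) }

  Den-sh : ∀ a → Commute Den (sh a)
  Den-sh a = commute-sym (sh a) Den (Den-commute (sh-linear a) (sh-sh a))

  Den-S : Commute Den S
  Den-S = commute-sym S Den (Den-commute S-linear λ a → commute-sym (sh a) S (sh-S a))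

  Den-T : Commute Den T
  Den-T = commute-sym T Den (Den-commute T-linear λ a → commute-sym (sh a) T (sh-T a))

  -- Den is a scalar and so commutes with y and T. Multiplying a system with constant `e` by it
  -- reaches the constant of `F-solves` without inverting a series.
  Den-solves : ∀ {c G} → Solves c G → Solves (Den c) (Den ∘ G)
  Den-solves {c} {G} s = record
    { base = ≈-trans (Den-linear .resp (s .base)) (≈-trans (Den-linear .add _ _) (⊞-cong ≈-refl (Den-S _)))
    ; next  = λ {j} j<r → begin
        Den (G (suc j))
          ≈⟨ Den-linear .resp (s .next j<r) ⟩
        Den (G j ⊞ sh (slot j 0) (T (G (suc j)) ⊞ S (G r)))
          ≈⟨ Den-linear .add _ _ ⟩
        Den (G j) ⊞ Den (sh (slot j 0) (T (G (suc j)) ⊞ S (G r)))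
          ≈⟨ ⊞-cong ≈-refl (Den-sh (slot j 0) _) ⟩
        Den (G j) ⊞ sh (slot j 0) (Den (T (G (suc j)) ⊞ S (G r)))
          ≈⟨ ⊞-cong ≈-refl (sh-linear (slot j 0) .resp
               (≈-trans (Den-linear .add _ _) (⊞-cong (Den-T _) (Den-S _)))) ⟩
        Den (G j) ⊞ sh (slot j 0) (T (Den (G (suc j))) ⊞ S (Den (G r))) ∎ }
    where open ≈-Reasoning

  ⊟-solves : ∀ {c G H} → Solves c G → Solves c H → Solves 0# (λ j → G j ⊟ H j)
  ⊟-solves {c} {G} {H} s t = record
    { base = begin
        G 0 ⊟ H 0                         ≈⟨ ⊟-cong (s .base) (t .base) ⟩
        (c ⊞ S (G r)) ⊟ (c ⊞ S (H r))     ≈⟨ ⊟⊞-interchange c c (S (G r)) (S (H r)) ⟨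
        (c ⊟ c) ⊞ (S (G r) ⊟ S (H r))     ≈⟨ ⊞-cong (mk≈ λ N v _ → ℤ.+-inverseʳ (at c N v)) (≈-sym (S-linear .sub _ _)) ⟩
        0# ⊞ S (G r ⊟ H r)                ∎
    ; next = λ {j} j<r → let x = slot j 0 in begin
        G (suc j) ⊟ H (suc j)
          ≈⟨ ⊟-cong (s .next j<r) (t .next j<r) ⟩
        (G j ⊞ sh x (T (G (suc j)) ⊞ S (G r))) ⊟ (H j ⊞ sh x (T (H (suc j)) ⊞ S (H r)))
          ≈⟨ ⊟⊞-interchange _ _ _ _ ⟨
        (G j ⊟ H j) ⊞ (sh x (T (G (suc j)) ⊞ S (G r)) ⊟ sh x (T (H (suc j)) ⊞ S (H r)))
          ≈⟨ ⊞-cong ≈-refl (≈-trans (≈-sym (sh-linear x .sub _ _)) (sh-linear x .resp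
               (≈-trans (≈-sym (⊟⊞-interchange _ _ _ _))
                 (⊞-cong (≈-sym (T-linear .sub _ _)) (≈-sym (S-linear .sub _ _)))))) ⟩
        (G j ⊟ H j) ⊞ sh x (T (G (suc j) ⊟ H (suc j)) ⊞ S (G r ⊟ H r)) ∎ }
    where open ≈-Reasoning

  -- Uniqueness of the solution

  Vanishes : ℕ → V → Set
  Vanishes t g = ∀ N v → head v ≤ M → degree v < t → at g N v ≡ 0ℤ

  degree-summand : ∀ a {v b : Index r} → v ≡ a ⊕ b → degree b ≤ degree v
  degree-summand a {b = b} refl = subst (degree b ≤_) (sym (degree-⊕ a b)) (ℕ.m≤n+m (degree b) (degree a))

  degree-summand-< : ∀ a {v b : Index r} → 1 ≤ degree a → v ≡ a ⊕ b → degree b < degree v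
  degree-summand-< a {b = b} 1≤a refl = subst (degree b <_) (sym (degree-⊕ a b)) (ℕ.+-monoˡ-≤ (degree b) 1≤a)

  sh-vanishes : ∀ a {t g} → Vanishes t g → Vanishes t (sh a g)
  sh-vanishes a z N v h dv = shift-vanish a v λ b eq →
    z N b (head-⊕ a eq h) (ℕ.≤-<-trans (degree-summand a eq) dv)

  S-vanishes : ∀ {t g} → Vanishes t g → Vanishes t (S g)
  S-vanishes z zero    v h dv = refl
  S-vanishes z (suc N) v h dv = z N v h dv

  Q-vanishes : ∀ {t g} → Vanishes t g → Vanishes t (Q g)
  Q-vanishes z N v h dv = shift-vanish (qpow N) v λ b eq →
    z N b (head-⊕ (qpow N) eq h) (ℕ.≤-<-trans (degree-summand (qpow N) eq) dv)

  ⊞-vanishes : ∀ {t f g} → Vanishes t f → Vanishes t g → Vanishes t (f ⊞ g)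
  ⊞-vanishes y z N v h dv = cong₂ ℤ._+_ (y N v h dv) (z N v h dv)

  T-vanishes : ∀ {t g} → Vanishes t g → Vanishes t (T g)
  T-vanishes {t} {g} z N v h dv = cong₂ ℤ._-_
    (⊞-vanishes {f = sh d (Q g)} {g = S (Q g)}
      (sh-vanishes d {g = Q g} (Q-vanishes {g = g} z)) (S-vanishes {g = Q g} (Q-vanishes {g = g} z)) N v h dv)
    (S-vanishes {g = g} z N v h dv)

  module _ {Y : ℕ → V} (s : Solves 0# Y) where

    -- Lexicographic induction on t, N, j. The factor u_j lowers the degree, which pays for keeping
    -- the index j + 1 at the same N inside T and for going back to r; the base equation passes from
    -- index 0 to r at the price of one unit of N.
    vanish : ∀ t N {j} → j ≤ r → ∀ v → head v ≤ M → degree v < t → at (Y j) N v ≡ 0ℤ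
    vanish (suc t) zero    {zero}  _   v h dv = at≈ (s .base) zero v h
    vanish (suc t) (suc N) {zero}  _   v h dv =
      trans (at≈ (s .base) (suc N) v h) (trans (ℤ.+-identityˡ _) (vanish (suc t) N ℕ.≤-refl v h dv))
    vanish (suc t) N       {suc j} j<r v h dv = trans (at≈ (s .next j<r) N v h) (cong₂ ℤ._+_
      (vanish (suc t) N (ℕ.<⇒≤ j<r) v h dv)
      (shift-vanish (slot j 0) v λ b eq →
        ⊞-vanishes {f = T (Y (suc j))} {g = S (Y r)}
          (T-vanishes λ N v h dv → vanish t N j<r v h dv)
          (S-vanishes {g = Y r} λ N v h dv → vanish t N ℕ.≤-refl v h dv)
          N b (head-⊕ (slot j 0) eq h)
          (ℕ.<-≤-trans (degree-summand-< (slot j 0) (degree-unit j<r) eq) (s≤s⁻¹ dv))))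

  Den-solution : ∀ {G} → Solves e G → Den (G r) ≈ prod L′ (allSlots r) I
  Den-solution {G} s = mk≈ λ N v h → trans
    (ℤ.i-j≡0⇒i≡j _ _ (vanish (⊟-solves (Den-solves s) F-solves) (suc (degree v)) N ℕ.≤-refl v h ℕ.≤-refl))
    (cong (λ g → at g N v) (trans F-last (low≡prod r)))

  -- The limit as N tends to infinity

  infix 4 _~_
  -- Equality of the coefficients for all large N. The threshold is uniform in `v`, so `sh`
  -- preserves the relation and inductions on the degree keep their threshold.
  record _~_ (f g : V) : Set where
    constructor mk~
    field
      from   : ℕ
      agrees : ∀ N v → from ≤ N → head v ≤ M → at f N v ≡ at g N v
  open _~_ public

  ≈⇒~ : ∀ {f g} → f ≈ g → f ~ g
  ≈⇒~ p = mk~ 0 λ N v _ → at≈ p N v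

  ~-sym : ∀ {f g} → f ~ g → g ~ f
  ~-sym p = mk~ (from p) λ N v le h → sym (agrees p N v le h)

  ~-trans : ∀ {f g h} → f ~ g → g ~ h → f ~ h
  ~-trans p q = mk~ (from p + from q) λ N v le h → trans
    (agrees p N v (ℕ.≤-trans (ℕ.m≤m+n _ _) le) h) (agrees q N v (ℕ.≤-trans (ℕ.m≤n+m _ _) le) h)

  ⊞-~ : ∀ {f f′ g g′} → f ~ f′ → g ~ g′ → f ⊞ g ~ f′ ⊞ g′
  ⊞-~ p q = mk~ (from p + from q) λ N v le h → cong₂ ℤ._+_
    (agrees p N v (ℕ.≤-trans (ℕ.m≤m+n _ _) le) h) (agrees q N v (ℕ.≤-trans (ℕ.m≤n+m _ _) le) h)

  ⊟-~ : ∀ {f f′ g g′} → f ~ f′ → g ~ g′ → f ⊟ g ~ f′ ⊟ g′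
  ⊟-~ p q = mk~ (from p + from q) λ N v le h → cong₂ ℤ._-_
    (agrees p N v (ℕ.≤-trans (ℕ.m≤m+n _ _) le) h) (agrees q N v (ℕ.≤-trans (ℕ.m≤n+m _ _) le) h)

  sh-~ : ∀ a {f g} → f ~ g → sh a f ~ sh a g
  sh-~ a p = mk~ (from p) λ N v le h → shift-cong a v λ b eq → agrees p N b le (head-⊕ a eq h)

  S-~ : ∀ {f g} → f ~ g → S f ~ S g
  S-~ p = mk~ (suc (from p)) λ { (suc N) v (s≤s le) h → agrees p N v le h }

  -- The coefficient of y^N is divisible by q^N, which vanishes modulo q^(M+1) once N > M.
  Q~0 : ∀ g → Q g ~ 0#
  Q~0 g = mk~ (suc M) λ N v le h → shift-vanish (qpow N) v λ b eq → ⊥-elim (too-big N b eq le h)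
    where
    too-big : ∀ N b {v} → v ≡ qpow N ⊕ b → M < N → ¬ (head v ≤ M)
    too-big N (y ∷ b) refl le h = ℕ.<-irrefl refl (ℕ.<-≤-trans le (ℕ.≤-trans (ℕ.m≤m+n N y) h))

  sh-0 : ∀ a → sh a 0# ≈ 0#
  sh-0 a = mk≈ λ N v h → shift-vanish a v λ _ _ → refl

  S-0 : S 0# ≈ 0#
  S-0 = mk≈ λ { zero v h → refl ; (suc N) v h → refl }

  P~0 : ∀ g → P g ~ 0#
  P~0 g = ~-trans (⊞-~ (sh-~ d (Q~0 g)) (S-~ (Q~0 g))) (≈⇒~ (≈-trans (⊞-cong (sh-0 d) S-0) (mk≈ λ _ _ _ → refl)))

  -- The coefficients are eventually constant in N, so that y acts in the limit as the identity.
  Stable : V → Set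
  Stable g = S g ~ g

  -- In the limit P becomes 0 and y becomes 1, so the bracket qP - y becomes -1.
  L′~E : ∀ x {g} → Stable g → L′ x g ~ E x g
  L′~E x {g} st = ~-trans (⊟-~ (≈⇒~ ≈-refl) (sh-~ x (⊟-~
      (~-trans (sh-~ q (P~0 g)) (≈⇒~ (sh-0 q))) st)))
    (≈⇒~ (≈-trans (⊟-cong ≈-refl (≈-trans (sh-linear x .sub 0# g) (⊟-cong (sh-0 x) ≈-refl)))
      (mk≈ λ N v _ → lemma (at g N v) (at (sh x g) N v))))
    where
    lemma : ∀ a b → a ℤ.- (0ℤ ℤ.- b) ≡ a ℤ.+ b
    lemma = solve-∀

  E-stable : ∀ x {g} → Stable g → Stable (E x g)
  E-stable x {g} st = ~-trans (≈⇒~ (≈-trans (S-linear .add _ _) (⊞-cong ≈-refl (≈-sym (sh-S x g)))))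
    (⊞-~ st (sh-~ x st))

  L′-~ : ∀ x {f g} → f ~ g → L′ x f ~ L′ x g
  L′-~ x p = ⊟-~ p (sh-~ x (⊟-~ (~-trans (sh-~ q (P~0 _)) (~-sym (sh-~ q (P~0 _)))) (S-~ p)))

  prod-L′~E : ∀ xs {g} → Stable g → prod L′ xs g ~ prod E xs g × Stable (prod E xs g)
  prod-L′~E []       st = ≈⇒~ ≈-refl , st
  prod-L′~E (x ∷ xs) st =
    let p , st′ = prod-L′~E xs st in ~-trans (L′-~ x p) (L′~E x st′) , E-stable x st′

  I-stable : Stable I
  I-stable = mk~ 1 λ { (suc N) v _ _ → refl }

  -- Induction on the degree: d x has positive degree, so the coefficient of `f` at `v` is
  -- determined by that of `D x f` and by coefficients of smaller degree, all at the same N.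
  D-injective : ∀ x {f g} → D x f ~ D x g → f ~ g
  D-injective x {f} {g} p = mk~ (from p) λ N v le h → go N le (suc (degree v)) v h ℕ.≤-refl
    where
    cancel : ∀ {a b c d} → a ℤ.- b ≡ c ℤ.- d → b ≡ d → a ≡ c
    cancel {a} {b} {c} eq refl = GroupProperties.∙-cancelʳ (AbelianGroup.group ℤ.+-0-abelianGroup) (ℤ.- b) a c eq
    go : ∀ N → from p ≤ N → ∀ t v → head v ≤ M → degree v < t → at f N v ≡ at g N v
    go N le (suc t) v h dv = cancel (agrees p N v le h) (shift-cong (d ⊕ x) v λ b eq →
      go N le t b (head-⊕ (d ⊕ x) eq h)
        (ℕ.<-≤-trans (degree-summand-< (d ⊕ x) positive eq) (s≤s⁻¹ dv)))
      where
      positive : 1 ≤ degree (d ⊕ x)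
      positive = subst (1 ≤_) (sym (degree-⊕ d x)) (s≤s z≤n)

  prod-D-injective : ∀ xs {f g} → prod D xs f ~ prod D xs g → f ~ g
  prod-D-injective []       p = p
  prod-D-injective (x ∷ xs) p = prod-D-injective xs (D-injective x p)

  solution-limit : ∀ {G a} → Solves e G → Den a ≈ prod E (allSlots r) I → G r ~ a
  solution-limit s p = prod-D-injective (allSlots r)
    (~-trans (≈⇒~ (Den-solution s)) (~-trans (proj₁ (prod-L′~E (allSlots r) I-stable)) (≈⇒~ (≈-sym p))))

-- Counting in setoids

module _ (S : Setoid 0ℓ 0ℓ) where
  open Setoid S using (Carrier; _≈_) renaming (refl to ≈-refl; sym to ≈-sym; trans to ≈-trans)

  -- An explicit enumeration instead of a bijection with `Fin c`: unions, differences and images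
  -- become operations on lists, and elements are compared as in the setoid, which multisets
  -- require.
  record Count (P : Pred Carrier 0ℓ) (c : ℕ) : Set where
    field
      list     : List Carrier
      unique   : AllPairs (λ x y → ¬ x ≈ y) list
      sound    : All P list
      complete : ∀ {x} → P x → Any (x ≈_) list
      size     : length list ≡ c

  open Count public

  lookup-injective : ∀ {xs} → AllPairs (λ x y → ¬ x ≈ y) xs → ∀ i j → List.lookup xs i ≈ List.lookup xs j → i ≡ j
  lookup-injective (_ ∷ _)   Fin.zero    Fin.zero    _  = refl
  lookup-injective (x≉ ∷ _)  Fin.zero    (Fin.suc j) eq = ⊥-elim (All.lookup x≉ (∈-lookup j) eq)
  lookup-injective (x≉ ∷ _)  (Fin.suc i) Fin.zero    eq = ⊥-elim (All.lookup x≉ (∈-lookup i) (≈-sym eq))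
  lookup-injective (_ ∷ uxs) (Fin.suc i) (Fin.suc j) eq = cong Fin.suc (lookup-injective uxs i j eq)

  cardinality : ∀ {P c} → Count P c → Sub S P HasCardinality c
  cardinality {P} record { list = xs ; unique = u ; sound = s ; complete = c ; size = refl } = record
    { to        = λ (x , px) → Any.index (c px)
    ; from      = λ i → List.lookup xs i , All.lookup s (∈-lookup i)
    ; to-cong   = λ {(x , px)} {(y , py)} x≈y → lookup-injective u _ _
        (≈-trans (≈-sym (Any.lookup-index (c px))) (≈-trans x≈y (Any.lookup-index (c py))))
    ; from-cong = λ { refl → ≈-refl }
    ; inverse   =
        (λ {i} {(x , px)} x≈ → lookup-injective u _ _ (≈-trans (≈-sym (Any.lookup-index (c px))) x≈)) ,
        (λ {(x , px)} eq → ≈-trans (reflexive (cong (List.lookup xs) eq)) (≈-sym (Any.lookup-index (c px))))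
    }
    where open Setoid S using (reflexive)

  -- Pigeonhole: sending an index of the first list to the position of its element in the second is
  -- injective.
  count-≤ : ∀ {P Q a b} → (∀ {x} → P x → Q x) → Count P a → Count Q b → a ≤ b
  count-≤ P⊆Q record { list = xs ; unique = u ; sound = s ; size = refl }
              record { list = ys ; complete = c ; size = refl } = Fin.injective⇒≤ {f = f} injective
    where
    found = λ i → c (P⊆Q (All.lookup s (∈-lookup i)))
    f = λ i → Any.index (found i)
    injective : ∀ {i j} → f i ≡ f j → i ≡ j
    injective {i} {j} eq = lookup-injective u i j (≈-trans (Any.lookup-index (found i))
      (≈-trans (reflexive (cong (List.lookup ys) eq)) (≈-sym (Any.lookup-index (found j)))))
      where open Setoid S using (reflexive)

  count-unique : ∀ {P Q a b} → (∀ {x} → P x → Q x) → (∀ {x} → Q x → P x) → Count P a → Count Q b → a ≡ b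
  count-unique P⊆Q Q⊆P p q = ℕ.≤-antisym (count-≤ P⊆Q p q) (count-≤ Q⊆P q p)

  count-resp : ∀ {P Q c} → (∀ {x} → P x → Q x) → (∀ {x} → Q x → P x) → Count P c → Count Q c
  count-resp P⊆Q Q⊆P p = record
    { list = list p ; unique = unique p ; sound = All.map P⊆Q (sound p)
    ; complete = λ qx → complete p (Q⊆P qx) ; size = size p }

  count-empty : ∀ {P} → (∀ {x} → ¬ P x) → Count P 0
  count-empty ¬P = record
    { list = [] ; unique = [] ; sound = [] ; complete = λ px → ⊥-elim (¬P px) ; size = refl }

  count-singleton : ∀ {P} x → P x → (∀ {y} → P y → y ≈ x) → Count P 1
  count-singleton x px only = record
    { list = x ∷ [] ; unique = [] ∷ [] ; sound = px ∷ [] ; complete = λ py → here (only py) ; size = refl }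

  count-⊎ : ∀ {P Q R a b} → (∀ {x y} → P x → Q y → ¬ x ≈ y) →
            (∀ {x} → P x → R x) → (∀ {x} → Q x → R x) → (∀ {x} → R x → P x ⊎ Q x) →
            Count P a → Count Q b → Count R (a + b)
  count-⊎ {P} {Q} disjoint P⊆R Q⊆R R⊆ p q = record
    { list     = list p ++ list q
    ; unique   = AllPairs.++⁺ (unique p) (unique q)
        (All.map (λ px → All.map (λ qy → disjoint px qy) (sound q)) (sound p))
    ; sound    = All.++⁺ (All.map P⊆R (sound p)) (All.map Q⊆R (sound q))
    ; complete = λ rx → found (R⊆ rx)
    ; size     = trans (List.length-++ (list p)) (cong₂ _+_ (size p) (size q)) }
    where
    found : ∀ {x} → P x ⊎ Q x → Any (x ≈_) (list p ++ list q)
    found (inj₁ px) = Any.++⁺ˡ (complete p px)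
    found (inj₂ qx) = Any.++⁺ʳ (list p) (complete q qx)

  -- By cancellation at most one `b` exists, so the union over `b` is one enumeration or empty. This
  -- is how removing a piece with exponent `a` becomes multiplication by a monomial.
  count-shift : ∀ {m} {P : Vec ℕ m → Pred Carrier 0ℓ} {g : Vec ℕ m → ℕ} a v →
                (∀ b → v ≡ a ⊕ b → Count (P b) (g b)) →
                Count (λ x → ∃[ b ] v ≡ a ⊕ b × P b x) (shift 0 a g v)
  count-shift {P = P} a v p with v -? a
  ... | yes (b , eq) = count-resp (λ px → b , eq , px)
          (λ {x} (c , eq′ , px) → subst (λ d → P d x) (⊕-cancelˡ a (trans (sym eq′) eq)) px) (p b eq)
  ... | no ¬p = count-empty λ (b , eq , _) → ¬p (b , eq)

  count-filter : ∀ {P Q a} (Q? : Decidable Q) → (∀ {x y} → x ≈ y → Q x → Q y) →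
                 (p : Count P a) → Count (λ x → P x × Q x) (length (filter Q? (list p)))
  count-filter {P} {Q} Q? Q-resp p = record
    { list     = filter Q? (list p)
    ; unique   = AllPairs.filter⁺ Q? (unique p)
    ; sound    = All.zip (All.filter⁺ Q? (sound p) , All.all-filter Q? (list p))
    ; complete = λ {x} (px , qx) → found qx (Any.filter⁺ Q? (complete p px)) (Any.lookup-result (complete p px))
    ; size     = refl }
    where
    found : ∀ {x y} → Q x → Any (x ≈_) (filter Q? (list p)) ⊎ ¬ Q y → x ≈ y → Any (x ≈_) (filter Q? (list p))
    found qx (inj₁ any) _   = any
    found qx (inj₂ ¬qy) x≈y = ⊥-elim (¬qy (Q-resp x≈y qx))

  -- This gives the negative term of T its combinatorial meaning, as the number of elements of a
  -- complement.
  count-∖ : ∀ {P Q a b} → Decidable Q → (∀ {x y} → x ≈ y → Q x → Q y) → (∀ {x} → Q x → P x) →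
            Count P a → Count Q b → ∃[ c ] Count (λ x → P x × ¬ Q x) c × c + b ≡ a
  count-∖ {P} {Q} {a} {b} Q? Q-resp Q⊆P p q = _ , rest , total
    where
    rest = count-filter (¬? ∘ Q?) (λ x≈y ¬qx qy → ¬qx (Q-resp (≈-sym x≈y) qy)) p
    split : ∀ xs → length (filter (¬? ∘ Q?) xs) + length (filter Q? xs) ≡ length xs
    split []       = refl
    split (x ∷ xs) with Q? x
    ... | yes _ = trans (ℕ.+-suc _ _) (cong suc (split xs))
    ... | no  _ = cong suc (split xs)
    total : length (filter (¬? ∘ Q?) (list p)) + b ≡ a
    total = trans (cong (length (filter (¬? ∘ Q?) (list p)) +_)
        (count-unique (λ qx → Q⊆P qx , qx) proj₂ q (count-filter Q? Q-resp p)))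
      (trans (split (list p)) (size p))

module _ (S S′ : Setoid 0ℓ 0ℓ) where
  open Setoid S using (Carrier; _≈_)
  open Setoid S′ using () renaming (Carrier to Carrier′; _≈_ to _≈′_; trans to ≈′-trans)

  count-map : ∀ {P : Pred Carrier 0ℓ} {Q : Pred Carrier′ 0ℓ} {c} (f : Carrier → Carrier′) →
              (∀ {x y} → x ≈ y → f x ≈′ f y) →
              (∀ {x y} → P x → P y → f x ≈′ f y → x ≈ y) →
              (∀ {x} → P x → Q (f x)) → (∀ {y} → Q y → ∃[ x ] P x × y ≈′ f x) →
              Count S P c → Count S′ Q c
  count-map {P} {Q} f f-cong f-inj sound′ complete′ p = record
    { list     = map f (list p)
    ; unique   = AllPairs.map⁺ (distinct (unique p) (sound p))
    ; sound    = All.map⁺ (All.map sound′ (sound p))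
    ; complete = λ qy → let x , px , y≈ = complete′ qy in
        Any.map⁺ (Any.map (λ x≈ → ≈′-trans y≈ (f-cong x≈)) (complete p px))
    ; size     = trans (List.length-map f (list p)) (size p) }
    where
    distinct : ∀ {xs} → AllPairs (λ x y → ¬ x ≈ y) xs → All P xs → AllPairs (λ x y → ¬ f x ≈′ f y) xs
    distinct []        []         = []
    distinct (x≉ ∷ u)  (px ∷ pxs) =
      All.zipWith (λ (x≉y , py) fx≈ → x≉y (f-inj px py fx≈)) (x≉ , pxs) ∷ distinct u pxs

-- Nonempty sets of colours and bounded sequences

-- `sole` is the set {0}, `skip` shifts a set up by one, `join` shifts it and adds 0. Every nonempty
-- set has exactly one such form, so its least element is found and removed by structural recursion.
data Subset⁺ : ℕ → Set where
  sole : ∀ {r} → Subset⁺ (suc r)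
  skip : ∀ {r} → Subset⁺ r → Subset⁺ (suc r)
  join : ∀ {r} → Subset⁺ r → Subset⁺ (suc r)

skip-injective : ∀ {r} {c c′ : Subset⁺ r} → skip c ≡ skip c′ → c ≡ c′
skip-injective refl = refl

card least greatest : ∀ {r} → Subset⁺ r → ℕ
card sole     = 1
card (skip c) = card c
card (join c) = suc (card c)
least sole     = 0
least (skip c) = suc (least c)
least (join c) = 0
greatest sole     = 0
greatest (skip c) = suc (greatest c)
greatest (join c) = suc (greatest c)

bits : ∀ {r} → Subset⁺ r → Vec ℕ r
bits sole     = 1 ∷ zeros
bits (skip c) = 0 ∷ bits c
bits (join c) = 1 ∷ bits c

1≤card : ∀ {r} (c : Subset⁺ r) → 1 ≤ card c
1≤card sole     = s≤s z≤n
1≤card (skip c) = 1≤card c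
1≤card (join c) = s≤s z≤n

least<r : ∀ {r} (c : Subset⁺ r) → least c < r
least<r sole     = s≤s z≤n
least<r (skip c) = s≤s (least<r c)
least<r (join c) = s≤s z≤n

singleton : ∀ {r} j → j < r → Subset⁺ r
singleton {suc r} zero    _         = sole
singleton {suc r} (suc j) (s≤s j<r) = skip (singleton j j<r)

card-singleton : ∀ {r} j (j<r : j < r) → card (singleton j j<r) ≡ 1
card-singleton {suc r} zero    _         = refl
card-singleton {suc r} (suc j) (s≤s j<r) = card-singleton j j<r

least-singleton : ∀ {r} j (j<r : j < r) → least (singleton j j<r) ≡ j
least-singleton {suc r} zero    _         = refl
least-singleton {suc r} (suc j) (s≤s j<r) = cong suc (least-singleton j j<r)

greatest-singleton : ∀ {r} j (j<r : j < r) → greatest (singleton j j<r) ≡ j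
greatest-singleton {suc r} zero    _         = refl
greatest-singleton {suc r} (suc j) (s≤s j<r) = cong suc (greatest-singleton j j<r)

bits-singleton : ∀ {r} j (j<r : j < r) → bits (singleton j j<r) ≡ unit r j
bits-singleton {suc r} zero    _         = refl
bits-singleton {suc r} (suc j) (s≤s j<r) = cong (0 ∷_) (bits-singleton j j<r)

-- Adds j to a set whose elements all exceed j; other sets are left unchanged.
insert : ∀ {r} → ℕ → Subset⁺ r → Subset⁺ r
insert zero    (skip c) = join c
insert (suc j) (skip c) = skip (insert j c)
insert _       c        = c

card-insert : ∀ {r} j (c : Subset⁺ r) → j < least c → card (insert j c) ≡ suc (card c)
card-insert zero    (skip c) _         = refl
card-insert (suc j) (skip c) (s≤s j<c) = card-insert j c j<c

least-insert : ∀ {r} j (c : Subset⁺ r) → j < least c → least (insert j c) ≡ j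
least-insert zero    (skip c) _         = refl
least-insert (suc j) (skip c) (s≤s j<c) = cong suc (least-insert j c j<c)

greatest-insert : ∀ {r} j (c : Subset⁺ r) → j < least c → greatest (insert j c) ≡ greatest c
greatest-insert zero    (skip c) _         = refl
greatest-insert (suc j) (skip c) (s≤s j<c) = cong suc (greatest-insert j c j<c)

bits-insert : ∀ {r} j (c : Subset⁺ r) → j < least c → bits (insert j c) ≡ unit r j ⊕ bits c
bits-insert zero    (skip c) _         = cong (1 ∷_) (sym (⊕-identityˡ (bits c)))
bits-insert (suc j) (skip c) (s≤s j<c) = cong (0 ∷_) (bits-insert j c j<c)

insert-injective : ∀ {r} j (c c′ : Subset⁺ r) → j < least c → j < least c′ → insert j c ≡ insert j c′ → c ≡ c′
insert-injective zero    (skip c) (skip c′) _         _          refl = refl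
insert-injective (suc j) (skip c) (skip c′) (s≤s j<c) (s≤s j<c′) eq   =
  cong skip (insert-injective j c c′ j<c j<c′ (skip-injective eq))

-- Deletion of the least colour: the two cases become the two kinds of tight sequences, with one or
-- with several primary colours in the first part.
uncons : ∀ {r} (c : Subset⁺ r) →
         (∃[ p ] c ≡ singleton (least c) p) ⊎ (∃[ c′ ] least c < least c′ × c ≡ insert (least c) c′)
uncons sole     = inj₁ (s≤s z≤n , refl)
uncons (join c) = inj₂ (skip c , s≤s z≤n , refl)
uncons (skip c) with uncons c
... | inj₁ (p , eq)      = inj₁ (s≤s p , cong skip eq)
... | inj₂ (c′ , p , eq) = inj₂ (skip c′ , s≤s p , cong skip eq)

singleton≢insert : ∀ {r} j (j<r : j < r) c → j < least c → singleton j j<r ≢ insert j c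
singleton≢insert (suc j) (s≤s p) (skip c) (s≤s q) eq = singleton≢insert j p c q (skip-injective eq)

[_≤_] : ℕ → ℕ → ℕ
[ zero  ≤ _     ] = 1
[ suc j ≤ zero  ] = 0
[ suc j ≤ suc m ] = [ j ≤ m ]

[≤]-yes : ∀ {j m} → j ≤ m → [ j ≤ m ] ≡ 1
[≤]-yes z≤n       = refl
[≤]-yes (s≤s j≤m) = [≤]-yes j≤m

[≤]-no : ∀ {j m} → m < j → [ j ≤ m ] ≡ 0
[≤]-no {suc j} {zero}  _         = refl
[≤]-no {suc j} {suc m} (s≤s m<j) = [≤]-no m<j

-- Only m = j feels the change of j to j + 1, so passing from f^j to f^(j+1) concerns first parts
-- with least colour j.
[≤]-suc : ∀ {j m} → m ≢ j → [ suc j ≤ m ] ≡ [ j ≤ m ]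
[≤]-suc {zero}  {zero}  m≢j = ⊥-elim (m≢j refl)
[≤]-suc {zero}  {suc m} m≢j = refl
[≤]-suc {suc j} {zero}  m≢j = refl
[≤]-suc {suc j} {suc m} m≢j = [≤]-suc (m≢j ∘ cong suc)

-- Bounded sequences and the recurrence for their numbers

module Sequences (r M : ℕ) where
  open Operators r M

  Seq : Set
  Seq = List (Part (Subset⁺ r))

  footprint : Part (Subset⁺ r) → ℕ
  footprint p = value p + card (colour p) + χ p

  Bounded : ℕ → ℕ → Seq → Set
  Bounded j N []       = ⊤
  Bounded j N (p ∷ ps) = footprint p + [ j ≤ least (colour p) ] ≤ suc N
                         × Bounded (suc (greatest (colour p))) (value p) ps

  partStat : Part (Subset⁺ r) → Index r
  partStat p = value p ∷ (if overlined p then 0 else 1) ∷ bits (colour p)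

  stat : Seq → Index r
  stat []       = zeros
  stat (p ∷ ps) = partStat p ⊕ stat ps

  Counted : (Seq → Set) → ℕ → Set
  Counted = Count (setoid Seq)

  InF : ℕ → ℕ → Index r → Seq → Set
  InF j N v ps = Bounded j N ps × stat ps ≡ v

  bounded? : ∀ j N ps → Dec (Bounded j N ps)
  bounded? j N []       = yes tt
  bounded? j N (p ∷ ps) = (_ ℕ.≤? _) ×-dec bounded? _ _ ps

  inF? : ∀ j N v ps → Dec (InF j N v ps)
  inF? j N v ps = bounded? j N ps ×-dec Vec.≡-dec ℕ._≟_ (stat ps) v

  relax : ∀ {j N} ps → Bounded j N ps → Bounded (suc j) N ps
  relax []       _       = tt
  relax {j} (p ∷ ps) (le , b) = ℕ.≤-trans (ℕ.+-monoʳ-≤ (footprint p) (mono j (least (colour p)))) le , b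
    where
    mono : ∀ j m → [ suc j ≤ m ] ≤ [ j ≤ m ]
    mono zero    zero    = z≤n
    mono zero    (suc m) = ℕ.≤-refl
    mono (suc j) zero    = z≤n
    mono (suc j) (suc m) = mono j m

  -- The sequences gained in passing from `Bounded j` to `Bounded (suc j)`: at least colour j the
  -- bracket drops from 1 to 0, which newly admits the first parts with footprint N + 1.
  Tight : ℕ → ℕ → Index r → Seq → Set
  Tight j N v []       = ⊥
  Tight j N v (p ∷ ps) = least (colour p) ≡ j × footprint p ≡ suc N
                         × Bounded (suc (greatest (colour p))) (value p) ps × stat (p ∷ ps) ≡ v

  tight-bounded : ∀ {j N v} ps → Tight j N v ps → InF (suc j) N v ps
  tight-bounded {N = N} (p ∷ ps) (refl , eq , b , st) =
    (subst (λ k → footprint p + k ≤ suc N) (sym ([≤]-no {m = least (colour p)} ℕ.≤-refl))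
      (ℕ.≤-reflexive (trans (ℕ.+-identityʳ _) eq)) , b) , st

  tight-disjoint : ∀ {j N v} ps → InF j N v ps → ¬ Tight j N v ps
  tight-disjoint {j} {N} (p ∷ ps) ((le , _) , _) (refl , eq , _) = ℕ.<-irrefl refl
    (subst (_≤ suc N) (trans (cong₂ _+_ eq ([≤]-yes {m = least (colour p)} ℕ.≤-refl)) (ℕ.+-comm (suc N) 1)) le)

  bounded-split : ∀ {j N v} ps → InF (suc j) N v ps → InF j N v ps ⊎ Tight j N v ps
  bounded-split []       (_ , st) = inj₁ (tt , st)
  bounded-split {j} {N} (p ∷ ps) ((le , b) , st) with least (colour p) ℕ.≟ j
  ... | no  ≢j = inj₁ ((subst (λ k → footprint p + k ≤ suc N) ([≤]-suc ≢j) le , b) , st)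
  ... | yes refl with ℕ.m≤n⇒m<n∨m≡n (subst (_≤ suc N)
          (trans (cong (footprint p +_) ([≤]-no {m = least (colour p)} ℕ.≤-refl)) (ℕ.+-identityʳ _)) le)
  ...   | inj₂ eq = inj₂ (refl , eq , b , st)
  ...   | inj₁ lt = inj₁ ((subst (_≤ suc N)
            (sym (trans (cong (footprint p +_) ([≤]-yes {m = least (colour p)} ℕ.≤-refl)) (ℕ.+-comm _ 1))) lt , b) , st)

  module _ {j : ℕ} (j<r : j < r) where

    lone : ℕ → Bool → Part (Subset⁺ r)
    lone N o = part N (singleton j j<r) o

    -- A part coloured u_j alone has greatest colour j, so what follows it is again bounded with
    -- index j + 1. Hence f^(j+1) reappears on the right of its own equation.
    Starts : Part (Subset⁺ r) → ℕ → Index r → Seq → Set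
    Starts p N v []        = ⊥
    Starts p N v (p′ ∷ ps) = p′ ≡ p × Bounded (suc j) N ps × stat (p′ ∷ ps) ≡ v

    count-starts : ∀ {p N v g} → (∀ b → v ≡ partStat p ⊕ b → Counted (InF (suc j) N b) (g b)) →
                   Counted (Starts p N v) (shift 0 (partStat p) g v)
    count-starts {p} {N} {v} {g} c = count-map (setoid Seq) (setoid Seq) (p ∷_) (cong (p ∷_))
      (λ { _ _ refl → refl })
      (λ { (b , refl , bd , refl) → refl , bd , refl })
      (λ { {p′ ∷ ps} (refl , bd , refl) → ps , (stat ps , refl , bd , refl) , refl })
      (count-shift (setoid Seq) (partStat p) v c)

    Inserted : ℕ → Index r → Seq → Set
    Inserted N v []       = ⊥
    Inserted N v (p ∷ ps) = ∃[ c ] j < least c × colour p ≡ insert j c × footprint (part (value p) c (overlined p)) ≡ suc N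
                            × Bounded (suc (greatest c)) (value p) ps × stat (p ∷ ps) ≡ v

    insertHead : Seq → Seq
    insertHead []       = []
    insertHead (p ∷ ps) = part (value p) (insert j (colour p)) (overlined p) ∷ ps

    -- A first part here has footprint N + 1 and least colour above j (`extra-head`): exactly the
    -- parts to which u_j can be added so as to attain the bound for N + 1. Their number f^r -
    -- f^(j+1) is the origin of the minus sign in T.
    Extra : ℕ → Index r → Seq → Set
    Extra N v ps = InF r N v ps × ¬ InF (suc j) N v ps

    extra-head : ∀ {N v} p ps → Extra N v (p ∷ ps) → j < least (colour p) × footprint p ≡ suc N
    extra-head {N} {v} p ps (((le , b) , st) , ¬f) = above , ℕ.≤-antisym le′ ge
      where
      le′ : footprint p ≤ suc N
      le′ = subst (_≤ suc N) (trans (cong (footprint p +_) ([≤]-no (least<r (colour p)))) (ℕ.+-identityʳ _)) le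
      above : j < least (colour p)
      above = ℕ.≰⇒> λ ≤j → ¬f ((subst (_≤ suc N)
        (sym (trans (cong (footprint p +_) ([≤]-no (s≤s ≤j))) (ℕ.+-identityʳ _))) le′ , b) , st)
      ge : suc N ≤ footprint p
      ge = ℕ.≮⇒≥ λ lt → ¬f ((subst (_≤ suc N)
        (sym (trans (cong (footprint p +_) ([≤]-yes above)) (ℕ.+-comm _ 1))) lt , b) , st)

    head-extra : ∀ {N v} p ps → j < least (colour p) → footprint p ≡ suc N →
                 Bounded (suc (greatest (colour p))) (value p) ps → stat (p ∷ ps) ≡ v → Extra N v (p ∷ ps)
    head-extra {N} p ps above eq b st =
      ((subst (_≤ suc N) (sym (trans (cong (footprint p +_) ([≤]-no (least<r (colour p)))) (ℕ.+-identityʳ _)))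
         (ℕ.≤-reflexive eq) , b) , st) ,
      λ ((le , _) , _) → ℕ.<-irrefl refl
        (subst (_≤ suc N) (trans (cong₂ _+_ eq ([≤]-yes above)) (ℕ.+-comm (suc N) 1)) le)

    stat-insert : ∀ p ps → j < least (colour p) → stat (insertHead (p ∷ ps)) ≡ slot j 0 ⊕ stat (p ∷ ps)
    stat-insert p ps above = trans (cong (_⊕ stat ps) (cong (λ b → value p ∷ _ ∷ b) (bits-insert j (colour p) above)))
      (⊕-assoc (slot j 0) (partStat p) (stat ps))

    insertHead-injective : ∀ {N N′ v v′ ps ps′} → Extra N v ps → Extra N′ v′ ps′ →
                           insertHead ps ≡ insertHead ps′ → ps ≡ ps′
    insertHead-injective {ps = []}     ((b , st) , ¬f) _ _ = ⊥-elim (¬f (tt , st))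
    insertHead-injective {ps = _ ∷ _} {[]} _ ((b , st) , ¬f) _ = ⊥-elim (¬f (tt , st))
    insertHead-injective {ps = p ∷ ps} {p′ ∷ ps′} x x′ eq = lemma refl refl eq
      where
      above  = proj₁ (extra-head p ps x)
      above′ = proj₁ (extra-head p′ ps′ x′)
      lemma : ∀ {c c′} → c ≡ insert j (colour p) → c′ ≡ insert j (colour p′) →
              part (value p) c (overlined p) ∷ ps ≡ part (value p′) c′ (overlined p′) ∷ ps′ → p ∷ ps ≡ p′ ∷ ps′
      lemma eqc eqc′ refl = cong (λ c → part (value p) c (overlined p) ∷ ps)
        (insert-injective j (colour p) (colour p′) above above′ (trans (sym eqc) eqc′))

    count-inserted : ∀ {N v g} → (∀ b → v ≡ slot j 0 ⊕ b → Counted (Extra N b) (g b)) →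
                     Counted (Inserted N v) (shift 0 (slot j 0) g v)
    count-inserted {N} {v} {g} c = count-map (setoid Seq) (setoid Seq) insertHead (cong insertHead)
      (λ (_ , _ , x) (_ , _ , x′) → insertHead-injective x x′)
      sound′ complete′ (count-shift (setoid Seq) (slot j 0) v c)
      where
      sound′ : ∀ {ps} → (∃[ b ] v ≡ slot j 0 ⊕ b × Extra N b ps) → Inserted N v (insertHead ps)
      sound′ {[]}     (b , refl , ((_ , st) , ¬f)) = ⊥-elim (¬f (tt , st))
      sound′ {p ∷ ps} (b , refl , x@(((_ , bd) , refl) , _)) =
        let above , eq = extra-head p ps x in
        colour p , above , refl , eq , bd , stat-insert p ps above
      complete′ : ∀ {ps} → Inserted N v ps → ∃[ qs ] (∃[ b ] v ≡ slot j 0 ⊕ b × Extra N b qs) × ps ≡ insertHead qs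
      complete′ {p ∷ ps} (c , above , refl , eq , bd , refl) =
        let q = part (value p) c (overlined p) in
        q ∷ ps , (stat (q ∷ ps) , stat-insert q ps above , head-extra q ps above eq bd refl) , refl

    footprint-lone : ∀ N o → footprint (lone N o) ≡ suc N + (if o then 1 else 0)
    footprint-lone N o = cong (_+ (if o then 1 else 0))
      (trans (cong (N +_) (card-singleton j j<r)) (ℕ.+-comm N 1))

    starts-tight : ∀ {N v} o ps → Starts (lone N o) N v ps → Tight j ((if o then 1 else 0) + N) v ps
    starts-tight {N} o (_ ∷ ps) (refl , bd , st) =
      least-singleton j j<r ,
      trans (footprint-lone N o) (trans (ℕ.+-comm (suc N) (if o then 1 else 0)) (ℕ.+-suc _ N)) ,
      subst (λ k → Bounded (suc k) N ps) (sym (greatest-singleton j j<r)) bd , st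

    inserted-tight : ∀ {N v} ps → Inserted N v ps → Tight j (suc N) v ps
    inserted-tight {N} (p ∷ ps) (c , above , refl , eq , bd , st) =
      least-insert j c above ,
      (begin
        value p + card (insert j c) + χ p ≡⟨ cong (λ k → value p + k + χ p) (card-insert j c above) ⟩
        value p + suc (card c) + χ p      ≡⟨ cong (_+ χ p) (ℕ.+-suc (value p) (card c)) ⟩
        suc (value p + card c + χ p)      ≡⟨ cong suc eq ⟩
        suc (suc N)                       ∎) ,
      subst (λ k → Bounded (suc k) (value p) ps) (sym (greatest-insert j c above)) bd , st
      where open ≡-Reasoning

    -- A single colour j leaves value + χ = N, so the value is N or, if overlined, N - 1. Otherwise
    -- removing j lowers the footprint by one; what remains is a nonempty set of colours, so its
    -- footprint is positive and N is at least 1.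
    tight-view : ∀ {N v} ps → Tight j N v ps →
      (∃[ o ] ∃[ N′ ] N ≡ (if o then 1 else 0) + N′ × Starts (lone N′ o) N′ v ps) ⊎
      (∃[ N′ ] N ≡ suc N′ × Inserted N′ v ps)
    tight-view {N} (p ∷ ps) (refl , eq , bd , st) with uncons (colour p)
    ... | inj₁ (p<r , c≡) = inj₁ (overlined p , value p ,
            ℕ.suc-injective (trans (sym eq) (trans (cong footprint p≡)
              (trans (footprint-lone (value p) (overlined p)) (trans (ℕ.+-comm (suc (value p)) _) (ℕ.+-suc _ _))))) ,
            p≡ , subst (λ k → Bounded (suc k) (value p) ps) (trans (cong greatest c≡′) (greatest-singleton _ j<r)) bd , st)
      where
      c≡′ : colour p ≡ singleton (least (colour p)) j<r
      c≡′ = trans c≡ (cong (singleton (least (colour p))) (ℕ.≤-irrelevant p<r j<r))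
      p≡ : p ≡ lone (value p) (overlined p)
      p≡ = cong (λ c → part (value p) c (overlined p)) c≡′
    ... | inj₂ (c , above , c≡) = inj₂ (pred (footprint p′) , trans N≡ 1+pred , c , above , c≡ , 1+pred ,
            subst (λ k → Bounded (suc k) (value p) ps) (trans (cong greatest c≡) (greatest-insert _ c above)) bd , st)
      where
      p′ = part (value p) c (overlined p)
      1+pred : footprint p′ ≡ suc (pred (footprint p′))
      1+pred = sym (ℕ.suc-pred (footprint p′) {{>-nonZero
        (ℕ.≤-trans (1≤card c) (ℕ.≤-trans (ℕ.m≤n+m _ (value p)) (ℕ.m≤m+n _ (χ p′))))}})
      N≡ : N ≡ footprint p′
      N≡ = ℕ.suc-injective (trans (sym eq) (trans
        (cong (λ k → value p + k + χ p) (trans (cong card c≡) (card-insert _ c above)))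
        (cong (_+ χ p) (ℕ.+-suc (value p) (card c)))))

    lone-disjoint : ∀ {N N′ v v′ o o′} ps → o ≢ o′ → Starts (lone N o) N v ps → ¬ Starts (lone N′ o′) N′ v′ ps
    lone-disjoint (_ ∷ _) o≢o′ (refl , _) (refl , _) = o≢o′ refl

    inserted-disjoint : ∀ {N N′ v v′ o} ps → Inserted N v ps → ¬ Starts (lone N′ o) N′ v′ ps
    inserted-disjoint (_ ∷ _) (c , above , eq , _) (refl , _) = singleton≢insert j j<r c above eq

    count-step : ∀ {N v a b} → Counted (InF j N v) a → Counted (Tight j N v) b → Counted (InF (suc j) N v) (a + b)
    count-step = count-⊎ (setoid Seq) (λ { {ps} f t refl → tight-disjoint ps f t })
      (λ { {ps} (b , st) → relax ps b , st }) (λ {ps} → tight-bounded ps) (λ {ps} → bounded-split ps)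

    count-tight-zero : ∀ {v g} →
      (∀ b → v ≡ partStat (lone 0 false) ⊕ b → Counted (InF (suc j) 0 b) (g b)) →
      Counted (Tight j 0 v) (shift 0 (partStat (lone 0 false)) g v)
    count-tight-zero {v} c = count-resp (setoid Seq) (λ {ps} → starts-tight false ps) (λ {ps} → starts ps) (count-starts c)
      where
      starts : ∀ ps → Tight j 0 v ps → Starts (lone 0 false) 0 v ps
      starts ps t with tight-view ps t
      -- The other cases make N a successor: an overlined part has χ = 1, and a part from which j
      -- was removed still has positive footprint.
      ... | inj₁ (false , _ , refl , s) = s

    -- The summands are the terms u_j d Q f^(j+1), u_j y Q f^(j+1) and u_j y (f^r - f^(j+1)) of the
    -- recurrence at y^(N+1).
    count-tight-suc : ∀ {N v g g′ h} →
      (∀ b → v ≡ partStat (lone (suc N) false) ⊕ b → Counted (InF (suc j) (suc N) b) (g b)) →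
      (∀ b → v ≡ partStat (lone N true) ⊕ b → Counted (InF (suc j) N b) (g′ b)) →
      (∀ b → v ≡ slot j 0 ⊕ b → Counted (Extra N b) (h b)) →
      Counted (Tight j (suc N) v)
        (shift 0 (partStat (lone (suc N) false)) g v + shift 0 (partStat (lone N true)) g′ v + shift 0 (slot j 0) h v)
    count-tight-suc {N} {v} c c′ k = count-⊎ (setoid Seq)
      (λ { {ps} (inj₁ s) i refl → inserted-disjoint ps i s ; {ps} (inj₂ s) i refl → inserted-disjoint ps i s })
      (λ { {ps} (inj₁ s) → starts-tight false ps s ; {ps} (inj₂ s) → starts-tight true ps s })
      (λ {ps} → inserted-tight ps) (λ {ps} → view ps)
      (count-⊎ (setoid Seq) {R = λ ps → Starts (lone (suc N) false) (suc N) v ps ⊎ Starts (lone N true) N v ps}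
        (λ { {ps} s s′ refl → lone-disjoint ps (λ ()) s s′ }) inj₁ inj₂ (λ x → x)
        (count-starts c) (count-starts c′))
      (count-inserted k)
      where
      view : ∀ ps → Tight j (suc N) v ps →
        (Starts (lone (suc N) false) (suc N) v ps ⊎ Starts (lone N true) N v ps) ⊎ Inserted N v ps
      view ps t with tight-view ps t
      ... | inj₁ (false , _ , refl , s) = inj₁ (inj₁ s)
      ... | inj₁ (true  , _ , refl , s) = inj₁ (inj₂ s)
      ... | inj₂ (_ , refl , i)         = inj₂ i

    count-extra : ∀ {N v a b} → Counted (InF r N v) a → Counted (InF (suc j) N v) b →
                  Counted (Extra N v) (a ∸ b) × b ≤ a
    count-extra {N} {v} {a} {b} p q with count-∖ (setoid Seq) (inF? (suc j) N v) (λ { refl f → f }) weaken p q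
      where
      weaken : ∀ {ps} → InF (suc j) N v ps → InF r N v ps
      weaken {[]}     f = f
      weaken {p ∷ ps} ((le , bd) , st) = (ℕ.≤-trans (ℕ.+-monoʳ-≤ (footprint p)
        (subst (_≤ [ suc j ≤ least (colour p) ]) (sym ([≤]-no (least<r (colour p)))) z≤n)) le , bd) , st
    ... | c , k , refl = subst (Counted (Extra N v)) (sym (ℕ.m+n∸n≡m c b)) k , ℕ.m≤n+m b c

  -- With j = 0 the bracket is 1, so a first part would have footprint 0; but its colour contains a
  -- primary colour.
  only-empty : ∀ {v} ps → InF 0 0 v ps → ps ≡ []
  only-empty []       _ = refl
  only-empty (p ∷ ps) ((le , _) , _) = ⊥-elim (ℕ.<-irrefl refl (ℕ.<-≤-trans positive
    (s≤s⁻¹ (subst (_≤ 1) (ℕ.+-comm (footprint p) 1) le))))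
    where
    positive : 0 < footprint p
    positive = ℕ.≤-trans (1≤card (colour p)) (ℕ.≤-trans (ℕ.m≤n+m _ (value p)) (ℕ.m≤m+n _ (χ p)))

  count-zero-zero : ∀ {v} → ∃[ c ] Counted (InF 0 0 v) c × ℤ.+ c ≡ one v
  count-zero-zero {v} with Vec.≡-dec ℕ._≟_ v zeros
  ... | yes refl = 1 , count-singleton (setoid Seq) [] (tt , refl) (λ {ps} → only-empty ps) , refl
  ... | no v≢0   = 0 , count-empty (setoid Seq) (λ {ps} f → v≢0 (empty ps f)) , refl
    where
    empty : ∀ ps → InF 0 0 v ps → v ≡ zeros
    empty ps f@(_ , st) = trans (sym st) (cong stat (only-empty ps f))

  -- Every least colour lies in 0, ..., r - 1, so the bracket is 0 for index r and 1 for index 0.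
  -- Hence index 0 at N + 1 is the same bound as index r at N, which is the base equation of the
  -- system.
  wrap-bound : ∀ p → suc (footprint p + [ r ≤ least (colour p) ]) ≡ footprint p + 1
  wrap-bound p = trans (cong (λ k → suc (footprint p + k)) ([≤]-no (least<r (colour p))))
    (trans (cong suc (ℕ.+-identityʳ _)) (ℕ.+-comm 1 _))

  wrap : ∀ {N v} ps → InF r N v ps → InF 0 (suc N) v ps
  wrap []       f = f
  wrap {N} (p ∷ ps) ((le , bd) , st) = (subst (_≤ suc (suc N)) (wrap-bound p) (s≤s le) , bd) , st

  unwrap : ∀ {N v} ps → InF 0 (suc N) v ps → InF r N v ps
  unwrap []       f = f
  unwrap {N} (p ∷ ps) ((le , bd) , st) = (s≤s⁻¹ (subst (_≤ suc (suc N)) (sym (wrap-bound p)) le) , bd) , st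

  -- From index r on the bracket is always 0. This lets `count-exists` step down from an arbitrary
  -- index.
  stationary : ∀ {j N v} → ¬ j < r → ∀ ps → InF (suc j) N v ps → InF j N v ps
  stationary j≮r []       f = f
  stationary {j} j≮r (p ∷ ps) ((le , bd) , st) =
    (subst (λ k → footprint p + k ≤ _) ([≤]-suc {j} {least (colour p)} λ { refl → j≮r (least<r (colour p)) }) le , bd) , st

  -- The recursion follows the lexicographic order t, N, j of `vanish`. It returns a whole function,
  -- guaranteed to be the count only below degree t, because `shift` takes its argument as a
  -- function.
  count-exists : ∀ t N j → Σ (Index r → ℕ) λ c → (∀ v → degree v < t → Counted (InF j N v) (c v))
  count-exists zero    N       j       = (λ _ → 0) , λ v ()
  count-exists (suc t) zero    zero    = (λ v → proj₁ (count-zero-zero {v})) , λ v _ → proj₁ (proj₂ count-zero-zero)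
  count-exists (suc t) (suc N) zero    =
    let c , k = count-exists (suc t) N r in
    c , λ v dv → count-resp (setoid Seq) (λ {ps} → wrap ps) (λ {ps} → unwrap ps) (k v dv)
  count-exists (suc t) N (suc j) with j ℕ.<? r
  ... | no j≮r =
    let c , k = count-exists (suc t) N j in
    c , λ v dv → count-resp (setoid Seq) (λ { {ps} (b , st) → relax ps b , st }) (λ {ps} → stationary j≮r ps) (k v dv)
  count-exists (suc t) zero (suc j) | yes j<r =
    let c , k   = count-exists (suc t) zero j
        c′ , k′ = count-exists t zero (suc j)
    in _ , λ v dv → count-step j<r (k v dv) (count-tight-zero j<r λ b eq → k′ b (smaller eq dv))
    where
    smaller : ∀ {v b} → v ≡ partStat (lone j<r 0 false) ⊕ b → degree v < suc t → degree b < t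
    smaller eq dv = ℕ.<-≤-trans (degree-summand-< (partStat (lone j<r 0 false)) (s≤s z≤n) eq) (s≤s⁻¹ dv)
  count-exists (suc t) (suc N) (suc j) | yes j<r =
    let c , k   = count-exists (suc t) (suc N) j
        c₁ , k₁ = count-exists t (suc N) (suc j)
        c₂ , k₂ = count-exists t N (suc j)
        c₃ , k₃ = count-exists t N r
    in _ , λ v dv → count-step j<r (k v dv) (count-tight-suc j<r
      (λ b eq → k₁ b (smaller (partStat (lone j<r (suc N) false)) (s≤s z≤n) eq dv))
      (λ b eq → k₂ b (smaller (partStat (lone j<r N true)) lone-positive eq dv))
      (λ b eq → let lt = smaller (slot j 0) (degree-unit j<r) eq dv in
         proj₁ (count-extra j<r (k₃ b lt) (k₂ b lt))))
    where
    lone-positive : 1 ≤ degree (partStat (lone j<r N true))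
    lone-positive = ℕ.≤-trans
      (subst (λ b → 1 ≤ degree b) (sym (bits-singleton j j<r)) (degree-unit j<r)) (ℕ.m≤n+m _ N)
    smaller : ∀ a {v b} → 1 ≤ degree a → v ≡ a ⊕ b → degree v < suc t → degree b < t
    smaller a 1≤a eq dv = ℕ.<-≤-trans (degree-summand-< a 1≤a eq) (s≤s⁻¹ dv)

  -- The numbers of bounded sequences solve the system

  f : ℕ → ℕ → Index r → ℕ
  f j N v = proj₁ (count-exists (suc (degree v)) N j) v

  f-count : ∀ j N v → Counted (InF j N v) (f j N v)
  f-count j N v = proj₂ (count-exists (suc (degree v)) N j) v ℕ.≤-refl

  f-unique : ∀ {j N v a} → Counted (InF j N v) a → f j N v ≡ a
  f-unique c = count-unique (setoid Seq) (λ x → x) (λ x → x) (f-count _ _ _) c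

  f-zero-zero : ∀ v → ℤ.+ f 0 0 v ≡ one v
  f-zero-zero v = let c , k , eq = count-zero-zero {v} in trans (cong ℤ.+_ (f-unique k)) eq

  f-wrap : ∀ N v → f 0 (suc N) v ≡ f r N v
  f-wrap N v = count-unique (setoid Seq) (λ {ps} → unwrap ps) (λ {ps} → wrap ps) (f-count 0 (suc N) v) (f-count r N v)

  module _ {j : ℕ} (j<r : j < r) where

    -- Makes the truncated subtraction in `f-step-suc` a true difference in ℤ.
    f≤f : ∀ N v → f (suc j) N v ≤ f r N v
    f≤f N v = proj₂ (count-extra j<r (f-count r N v) (f-count (suc j) N v))

    f-step-zero : ∀ v → f (suc j) 0 v ≡ f j 0 v + shift 0 (partStat (lone j<r 0 false)) (f (suc j) 0) v
    f-step-zero v = f-unique (count-step j<r (f-count j 0 v) (count-tight-zero j<r λ b _ → f-count (suc j) 0 b))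

    f-step-suc : ∀ N v → f (suc j) (suc N) v ≡ f j (suc N) v +
      (shift 0 (partStat (lone j<r (suc N) false)) (f (suc j) (suc N)) v
       + shift 0 (partStat (lone j<r N true)) (f (suc j) N) v
       + shift 0 (slot j 0) (λ b → f r N b ∸ f (suc j) N b) v)
    f-step-suc N v = f-unique (count-step j<r (f-count j (suc N) v) (count-tight-suc j<r
      (λ b _ → f-count (suc j) (suc N) b) (λ b _ → f-count (suc j) N b)
      (λ b _ → proj₁ (count-extra j<r (f-count r N b) (f-count (suc j) N b)))))

    shift-lone-false : ∀ N g v → ℤ.+ shift 0 (partStat (lone j<r N false)) g v ≡
      shift 0ℤ (slot j 0) (shift 0ℤ d (shift 0ℤ (qpow N) (ℤ.+_ ∘ g))) v
    shift-lone-false N g v = begin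
      ℤ.+ shift 0 (partStat (lone j<r N false)) g v
        ≡⟨ shift-map ℤ.+_ (partStat (lone j<r N false)) v ⟩
      shift 0ℤ (partStat (lone j<r N false)) (ℤ.+_ ∘ g) v
        ≡⟨ cong (λ b → shift 0ℤ (N ∷ 1 ∷ b) (ℤ.+_ ∘ g) v) (trans (bits-singleton j j<r)
             (sym (trans (cong (unit r j ⊕_) (⊕-identityˡ zeros)) (⊕-identityʳ _)))) ⟩
      shift 0ℤ (slot j 0 ⊕ (d ⊕ qpow N)) (ℤ.+_ ∘ g) v
        ≡⟨ shift-⊕ (slot j 0) (d ⊕ qpow N) v ⟩
      shift 0ℤ (slot j 0) (shift 0ℤ (d ⊕ qpow N) (ℤ.+_ ∘ g)) v
        ≡⟨ shift-cong (slot j 0) v (λ b _ → shift-⊕ d (qpow N) b) ⟩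
      shift 0ℤ (slot j 0) (shift 0ℤ d (shift 0ℤ (qpow N) (ℤ.+_ ∘ g))) v ∎
      where open ≡-Reasoning

    shift-lone-true : ∀ N g v → ℤ.+ shift 0 (partStat (lone j<r N true)) g v ≡
      shift 0ℤ (slot j 0) (shift 0ℤ (qpow N) (ℤ.+_ ∘ g)) v
    shift-lone-true N g v = begin
      ℤ.+ shift 0 (partStat (lone j<r N true)) g v
        ≡⟨ shift-map ℤ.+_ (partStat (lone j<r N true)) v ⟩
      shift 0ℤ (partStat (lone j<r N true)) (ℤ.+_ ∘ g) v
        ≡⟨ cong (λ b → shift 0ℤ (N ∷ 0 ∷ b) (ℤ.+_ ∘ g) v) (trans (bits-singleton j j<r) (sym (⊕-identityʳ _))) ⟩
      shift 0ℤ (slot j 0 ⊕ qpow N) (ℤ.+_ ∘ g) v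
        ≡⟨ shift-⊕ (slot j 0) (qpow N) v ⟩
      shift 0ℤ (slot j 0) (shift 0ℤ (qpow N) (ℤ.+_ ∘ g)) v ∎
      where open ≡-Reasoning

  G : ℕ → V
  at (G j) N v = ℤ.+ f j N v

  private
    regroup : ∀ a b c d → a ℤ.+ b ℤ.+ (c ℤ.- d) ≡ a ℤ.+ b ℤ.- d ℤ.+ c
    regroup = solve-∀

    a+0-0+0 : ∀ a → a ≡ a ℤ.+ 0ℤ ℤ.- 0ℤ ℤ.+ 0ℤ
    a+0-0+0 = solve-∀

  G-solves : Solves e G
  G-solves = record { base = mk≈ base′ ; next = λ {j} j<r → mk≈ (next′ j<r) }
    where
    base′ : ∀ N v → _ → at (G 0) N v ≡ at (e ⊞ S (G r)) N v
    base′ zero    v _ = trans (f-zero-zero v) (sym (ℤ.+-identityʳ _))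
    base′ (suc N) v _ = cong ℤ.+_ (f-wrap N v)
    next′ : ∀ {j} → j < r → ∀ N v → _ → at (G (suc j)) N v ≡ at (G j ⊞ sh (slot j 0) (T (G (suc j)) ⊞ S (G r))) N v
    next′ {j} j<r zero v _ = begin
      ℤ.+ f (suc j) 0 v
        ≡⟨ cong ℤ.+_ (f-step-zero j<r v) ⟩
      ℤ.+ f j 0 v ℤ.+ ℤ.+ shift 0 (partStat (lone j<r 0 false)) (f (suc j) 0) v
        -- At N = 0 the three terms with a factor y are 0, and only d Q is left.
        ≡⟨ cong (ℤ._+_ (ℤ.+ f j 0 v)) (trans (shift-lone-false j<r 0 _ v)
             (shift-cong (slot j 0) v λ b _ → a+0-0+0 _)) ⟩
      at (G j ⊞ sh (slot j 0) (T (G (suc j)) ⊞ S (G r))) 0 v ∎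
      where open ≡-Reasoning
    next′ {j} j<r (suc N) v _ = begin
      ℤ.+ f (suc j) (suc N) v
        ≡⟨ cong ℤ.+_ (f-step-suc j<r N v) ⟩
      ℤ.+ f j (suc N) v ℤ.+ (ℤ.+ t₁ ℤ.+ ℤ.+ t₂ ℤ.+ ℤ.+ t₃)
        ≡⟨ cong (ℤ._+_ (ℤ.+ f j (suc N) v)) (cong₂ ℤ._+_
             (cong₂ ℤ._+_ (shift-lone-false j<r (suc N) _ v) (shift-lone-true j<r N _ v))
             (trans (shift-map ℤ.+_ (slot j 0) v) (shift-cong (slot j 0) v λ b _ →
               trans (sym (ℤ.⊖-≥ (f≤f j<r N b))) (sym (ℤ.m-n≡m⊖n (f r N b) (f (suc j) N b)))))) ⟩
      ℤ.+ f j (suc N) v ℤ.+ (shift 0ℤ (slot j 0) s₁ v ℤ.+ shift 0ℤ (slot j 0) s₂ v ℤ.+ shift 0ℤ (slot j 0) s₃ v)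
        ≡⟨ cong (ℤ._+_ (ℤ.+ f j (suc N) v)) (trans
             (cong (ℤ._+ shift 0ℤ (slot j 0) s₃ v) (sym (shift-zip ℤ._+_ refl (slot j 0) v)))
             (sym (shift-zip ℤ._+_ refl (slot j 0) v))) ⟩
      ℤ.+ f j (suc N) v ℤ.+ shift 0ℤ (slot j 0) (λ b → s₁ b ℤ.+ s₂ b ℤ.+ s₃ b) v
        -- The difference f^r - f^(j+1) is taken apart: its negative half joins P to form T.
        ≡⟨ cong (ℤ._+_ (ℤ.+ f j (suc N) v)) (shift-cong (slot j 0) v λ b _ →
             regroup (s₁ b) (s₂ b) (ℤ.+ f r N b) (ℤ.+ f (suc j) N b)) ⟩
      at (G j ⊞ sh (slot j 0) (T (G (suc j)) ⊞ S (G r))) (suc N) v ∎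
      where
      open ≡-Reasoning
      t₁ = shift 0 (partStat (lone j<r (suc N) false)) (f (suc j) (suc N)) v
      t₂ = shift 0 (partStat (lone j<r N true)) (f (suc j) N) v
      t₃ = shift 0 (slot j 0) (λ b → f r N b ∸ f (suc j) N b) v
      s₁ s₂ s₃ : Index r → ℤ
      s₁ = shift 0ℤ d (shift 0ℤ (qpow (suc N)) (λ b → ℤ.+ f (suc j) (suc N) b))
      s₂ = shift 0ℤ (qpow N) (λ b → ℤ.+ f (suc j) N b)
      s₃ b = ℤ.+ f r N b ℤ.- ℤ.+ f (suc j) N b

-- Overpartitions

module Overpartitions (r M : ℕ) where
  open Operators r M

  Overpart : Set
  Overpart = Part (Fin r)

  -- An overpartition is an independent choice, for each slot, of a number of plain copies and of at
  -- most one overlined copy; slots can therefore be added one at a time.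
  Slot : Set
  Slot = Fin r × ℕ

  slotOf : Overpart → Slot
  slotOf p = colour p , value p

  vector : Slot → Index r
  vector (i , m) = slot (toℕ i) m

  partOf : Slot → Bool → Overpart
  partOf (i , m) o = part m i o

  _≟ₚ_ : (p p′ : Overpart) → Dec (p ≡ p′)
  part m i o ≟ₚ part m′ i′ o′ = map′ (λ { (refl , refl , refl) → refl }) (λ { refl → refl , refl , refl })
    ((m ℕ.≟ m′) ×-dec (i Fin.≟ i′) ×-dec (o Bool.≟ o′))

  overStat : Overpart → Index r
  overStat p = value p ∷ (if overlined p then 0 else 1) ∷ unit r (toℕ (colour p))

  multiStat : List Overpart → Index r
  multiStat []       = zeros
  multiStat (p ∷ ps) = overStat p ⊕ multiStat ps

  multiStat-↭ : ∀ {ps qs} → ps ↭ qs → multiStat ps ≡ multiStat qs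
  multiStat-↭ _↭_.refl         = refl
  multiStat-↭ (prep x e)       = cong (overStat x ⊕_) (multiStat-↭ e)
  multiStat-↭ (swap x y e)     = trans (sym (⊕-assoc (overStat x) (overStat y) _))
    (trans (cong₂ _⊕_ (⊕-comm (overStat x) (overStat y)) (multiStat-↭ e)) (⊕-assoc (overStat y) (overStat x) _))
  multiStat-↭ (_↭_.trans e e′) = trans (multiStat-↭ e) (multiStat-↭ e′)

  IsOver : Fin r → ℕ → Overpart → Set
  IsOver c m p = colour p ≡ c × value p ≡ m × overlined p ≡ true

  Over : List Overpart → Set
  Over ps = ∀ c m → #overlined c m ps ≤ 1

  over-count-↭ : ∀ c m {ps qs : List Overpart} → ps ↭ qs → #overlined c m ps ≡ #overlined c m qs
  over-count-↭ c m e = ↭.↭-length (↭.filter-↭ _ e)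

  over-count-reject : ∀ c m p ps → ¬ IsOver c m p → #overlined c m (p ∷ ps) ≡ #overlined c m ps
  over-count-reject c m p ps ¬o = cong length (List.filter-reject _ {xs = ps} ¬o)

  over-count-accept : ∀ c m p ps → IsOver c m p → #overlined c m (p ∷ ps) ≡ suc (#overlined c m ps)
  over-count-accept c m p ps o = cong length (List.filter-accept _ {xs = ps} o)

  isOver? : ∀ c m p → Dec (IsOver c m p)
  isOver? c m p = (colour p Fin.≟ c) ×-dec (value p ℕ.≟ m) ×-dec (overlined p Bool.≟ true)

  over-count-tail : ∀ c m p ps → #overlined c m ps ≤ #overlined c m (p ∷ ps)
  over-count-tail c m p ps with isOver? c m p
  ... | yes o = subst (#overlined c m ps ≤_) (sym (over-count-accept c m p ps o)) (ℕ.n≤1+n _)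
  ... | no ¬o = ℕ.≤-reflexive (sym (over-count-reject c m p ps ¬o))

  over-count-none : ∀ c m ps → part m c true ∉ ps → #overlined c m ps ≡ 0
  over-count-none c m []       _  = refl
  over-count-none c m (p ∷ ps) p∉ = trans (over-count-reject c m p ps λ { (refl , refl , refl) → p∉ (here refl) })
    (over-count-none c m ps (p∉ ∘ there))

  over-count-some : ∀ c m ps → part m c true ∈ ps → 1 ≤ #overlined c m ps
  over-count-some c m (p ∷ ps) (here refl) = subst (1 ≤_) (sym (over-count-accept c m p ps (refl , refl , refl))) (s≤s z≤n)
  over-count-some c m (p ∷ ps) (there p∈)  = ℕ.≤-trans (over-count-some c m ps p∈) (over-count-tail c m p ps)

  InSlots : List Slot → List Overpart → Set
  InSlots sl ps = All (λ p → slotOf p ∈ sl) ps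

  InO : List Slot → Index r → List Overpart → Set
  InO sl v ps = InSlots sl ps × Over ps × multiStat ps ≡ v

  extract : ∀ {p : Overpart} {ps} → p ∈ ps → ∃[ qs ] ps ↭ p ∷ qs
  extract p∈ with ys , zs , refl ← ∈-∃++ p∈ = ys ++ zs , ↭.shift _ ys zs

  inO-↭ : ∀ {sl v ps qs} → ps ↭ qs → InO sl v ps → InO sl v qs
  inO-↭ e (s , o , st) = ↭.All-resp-↭ e s ,
    (λ c m → subst (_≤ 1) (over-count-↭ c m e) (o c m)) , trans (sym (multiStat-↭ e)) st

  inO-tail : ∀ {sl p ps v} → InO sl v (p ∷ ps) → v ≡ overStat p ⊕ multiStat ps × InO sl (multiStat ps) ps
  inO-tail {p = p} {ps} (_ ∷ s , o , st) =
    sym st , s , (λ c m → ℕ.≤-trans (over-count-tail c m p ps) (o c m)) , refl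

  Counted : (List Overpart → Set) → ℕ → Set
  Counted = Count (↭-setoid {A = Overpart})

  module _ {s : Slot} {sl : List Slot} (s∉sl : s ∉ sl) where

    p₀ p₁ : Overpart
    p₀ = partOf s false
    p₁ = partOf s true

    -- Together with the overpartitions avoiding the slot, these are the classes behind a′ = a + x a
    -- + d x a′, that is (1 - d x) a′ = (1 + x) a. Removing a plain copy leaves an arbitrary
    -- overpartition on the same slots; if there is no plain copy, removing the overlined one
    -- empties the slot.
    HasPlain HasOver : Index r → List Overpart → Set
    HasPlain v ps = InO (s ∷ sl) v ps × p₀ ∈ ps
    HasOver  v ps = InO (s ∷ sl) v ps × p₀ ∉ ps × p₁ ∈ ps

    count-plain : ∀ {v g} → (∀ b → v ≡ overStat p₀ ⊕ b → Counted (InO (s ∷ sl) b) (g b)) →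
                  Counted (HasPlain v) (shift 0 (overStat p₀) g v)
    count-plain {v} {g} c = count-map ↭-setoid ↭-setoid (p₀ ∷_) (prep p₀) (λ _ _ → ↭.drop-∷)
      (λ { {ps} (b , refl , ins , o , refl) → (here refl ∷ ins ,
             (λ c m → subst (_≤ 1) (sym (over-count-reject c m p₀ ps λ ())) (o c m)) , refl) , here refl })
      complete′ (count-shift ↭-setoid (overStat p₀) v c)
      where
      complete′ : ∀ {ps} → HasPlain v ps → ∃[ qs ] (∃[ b ] v ≡ overStat p₀ ⊕ b × InO (s ∷ sl) b qs) × ps ↭ p₀ ∷ qs
      complete′ (io , p∈) =
        let qs , e = extract p∈
            st , io′ = inO-tail (inO-↭ e io)
        in qs , (multiStat qs , st , io′) , e

    not-in-slot : ∀ {ps} o → InSlots sl ps → partOf s o ∉ ps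
    not-in-slot o ins p∈ = s∉sl (All.lookup ins p∈)

    strengthen : ∀ {ps} → InSlots (s ∷ sl) ps → p₀ ∉ ps → p₁ ∉ ps → InSlots sl ps
    strengthen {[]}                _                _  _  = []
    strengthen {part m i false ∷ ps} (here refl ∷ ins) ∉₀ ∉₁ = ⊥-elim (∉₀ (here refl))
    strengthen {part m i true ∷ ps}  (here refl ∷ ins) ∉₀ ∉₁ = ⊥-elim (∉₁ (here refl))
    strengthen {p ∷ ps}            (there i ∷ ins)  ∉₀ ∉₁ = i ∷ strengthen ins (∉₀ ∘ there) (∉₁ ∘ there)

    count-over : ∀ {v g} → (∀ b → v ≡ overStat p₁ ⊕ b → Counted (InO sl b) (g b)) →
                 Counted (HasOver v) (shift 0 (overStat p₁) g v)
    count-over {v} {g} c = count-map ↭-setoid ↭-setoid (p₁ ∷_) (prep p₁) (λ _ _ → ↭.drop-∷)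
      sound′ complete′ (count-shift ↭-setoid (overStat p₁) v c)
      where
      over′ : ∀ ps → InSlots sl ps → Over ps → Over (p₁ ∷ ps)
      over′ ps ins o c m with isOver? c m p₁
      ... | yes is@(refl , refl , _) = ℕ.≤-reflexive (trans (over-count-accept c m p₁ ps is)
              (cong suc (over-count-none c m ps (not-in-slot true ins))))
      ... | no ¬is = subst (_≤ 1) (sym (over-count-reject c m p₁ ps ¬is)) (o c m)
      sound′ : ∀ {ps} → (∃[ b ] v ≡ overStat p₁ ⊕ b × InO sl b ps) → HasOver v (p₁ ∷ ps)
      sound′ {ps} (b , refl , ins , o , refl) =
        (here refl ∷ All.map there ins , over′ ps ins o , refl) ,
        (λ { (there p∈) → not-in-slot false ins p∈ }) , here refl
      complete′ : ∀ {ps} → HasOver v ps → ∃[ qs ] (∃[ b ] v ≡ overStat p₁ ⊕ b × InO sl b qs) × ps ↭ p₁ ∷ qs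
      complete′ (io , ∉₀ , ∈₁) =
        let qs , e = extract ∈₁
            io₁@(_ , o₁ , _) = inO-↭ e io
            st , ins , o , st′ = inO-tail io₁
            -- A second overlined copy in the same slot would make the count 2, against `Over`.
            ∉₁ = λ p∈ → ℕ.<-irrefl refl (ℕ.<-≤-trans
              (subst (1 <_) (sym (over-count-accept (proj₁ s) (proj₂ s) p₁ qs (refl , refl , refl)))
                (s≤s (over-count-some _ _ qs p∈)))
              (o₁ (proj₁ s) (proj₂ s)))
        in qs , (multiStat qs , st , strengthen ins (λ p∈ → ∉₀ (↭.∈-resp-↭ (↭-sym e) (there p∈))) ∉₁ , o , st′) , e

    count-slot : ∀ {v a b c} → Counted (InO sl v) a → Counted (HasOver v) b → Counted (HasPlain v) c →
                 Counted (InO (s ∷ sl) v) (a + b + c)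
    count-slot {v} ca cb cc = count-⊎ ↭-setoid disjoint₀ weaken proj₁ split₀
      (count-⊎ ↭-setoid {R = λ ps → InO (s ∷ sl) v ps × p₀ ∉ ps} disjoint₁
        (λ (ins , o , st) → (All.map there ins , o , st) , not-in-slot false ins)
        (λ (io , ∉₀ , _) → io , ∉₀) split₁ ca cb) cc
      where
      weaken : ∀ {ps} → InO (s ∷ sl) v ps × p₀ ∉ ps → InO (s ∷ sl) v ps
      weaken = proj₁
      disjoint₀ : ∀ {ps qs} → InO (s ∷ sl) v ps × p₀ ∉ ps → HasPlain v qs → ¬ (ps ↭ qs)
      disjoint₀ (_ , ∉₀) (_ , ∈₀) e = ∉₀ (↭.∈-resp-↭ (↭-sym e) ∈₀)
      disjoint₁ : ∀ {ps qs} → InO sl v ps → HasOver v qs → ¬ (ps ↭ qs)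
      disjoint₁ (ins , _) (_ , _ , ∈₁) e = not-in-slot true ins (↭.∈-resp-↭ (↭-sym e) ∈₁)
      split₀ : ∀ {ps} → InO (s ∷ sl) v ps → (InO (s ∷ sl) v ps × p₀ ∉ ps) ⊎ HasPlain v ps
      split₀ {ps} io with any? (p₀ ≟ₚ_) ps
      ... | yes ∈₀ = inj₂ (io , ∈₀)
      ... | no ∉₀  = inj₁ (io , ∉₀)
      split₁ : ∀ {ps} → InO (s ∷ sl) v ps × p₀ ∉ ps → InO sl v ps ⊎ HasOver v ps
      split₁ {ps} (io@(ins , o , st) , ∉₀) with any? (p₁ ≟ₚ_) ps
      ... | yes ∈₁ = inj₂ (io , ∉₀ , ∈₁)
      ... | no ∉₁  = inj₁ (strengthen ins ∉₀ ∉₁ , o , st)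

  count-no-slots : ∀ {v} → ∃[ c ] Counted (InO [] v) c × ℤ.+ c ≡ one v
  count-no-slots {v} with Vec.≡-dec ℕ._≟_ v zeros
  ... | yes refl = 1 , count-singleton ↭-setoid [] ([] , (λ c m → z≤n) , refl)
    (λ { {[]} _ → ↭-refl ; {_ ∷ _} (() ∷ _ , _) }) , refl
  ... | no v≢0   = 0 , count-empty ↭-setoid (λ { {[]} (_ , _ , st) → v≢0 (sym st) ; {_ ∷ _} (() ∷ _ , _) }) , refl

  -- Recursion on the slots and on the degree: removing an overlined copy shortens the list at the
  -- same t, while removing a plain copy keeps the list and lowers the degree through the exponent
  -- of d.
  overpartition-count : ∀ sl → Unique sl → ∀ t → Σ (Index r → ℕ) λ c → (∀ v → degree v < t → Counted (InO sl v) (c v))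
  overpartition-count sl       u          zero    = (λ _ → 0) , λ v ()
  overpartition-count []       u          (suc t) =
    (λ v → proj₁ (count-no-slots {v})) , λ v _ → proj₁ (proj₂ count-no-slots)
  overpartition-count (s ∷ sl) u@(s≢ ∷ u′) (suc t) =
    let c  , k  = overpartition-count sl u′ (suc t)
        c′ , k′ = overpartition-count (s ∷ sl) u t
    in (λ v → c v + shift 0 (overStat (partOf s true)) c v + shift 0 (overStat (partOf s false)) c′ v) ,
       λ v dv → count-slot s∉ (k v dv)
         (count-over s∉ λ b eq → k b (ℕ.≤-<-trans (degree-summand (overStat (partOf s true)) eq) dv))
         (count-plain s∉ λ b eq → k′ b (ℕ.<-≤-trans
           (degree-summand-< (overStat (partOf s false)) (ℕ.≤-trans (s≤s z≤n) (ℕ.m≤n+m _ (proj₂ s))) eq) (s≤s⁻¹ dv)))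
    where
    s∉ : s ∉ sl
    s∉ s∈ = All.lookup s≢ s∈ refl

  module _ {sl : List Slot} (u : Unique sl) where

    a : Index r → ℕ
    a v = proj₁ (overpartition-count sl u (suc (degree v))) v

    a-count : ∀ v → Counted (InO sl v) (a v)
    a-count v = proj₂ (overpartition-count sl u (suc (degree v))) v ℕ.≤-refl

    a-unique : ∀ {v c} → Counted (InO sl v) c → a v ≡ c
    a-unique c = count-unique ↭-setoid (λ x → x) (λ x → x) (a-count _) c

    -- The series a/(1 - y), constant in N and hence its own limit.
    aᵛ : V
    at aᵛ _ v = ℤ.+ a v

  aᵛ-[] : ∀ (u : Unique []) → aᵛ u ≈ I
  aᵛ-[] u = mk≈ λ N v _ → let c , k , eq = count-no-slots {v} in trans (cong ℤ.+_ (a-unique u k)) eq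

  aᵛ-∷ : ∀ {s sl} (u : Unique sl) (u′ : Unique (s ∷ sl)) → D (vector s) (aᵛ u′) ≈ E (vector s) (aᵛ u)
  aᵛ-∷ {s} {sl} u u′@(s≢ ∷ _) = mk≈ λ N v _ → begin
    ℤ.+ a u′ v ℤ.- shift 0ℤ (d ⊕ vector s) (ℤ.+_ ∘ a u′) v
      ≡⟨ cong (λ k → ℤ.+ k ℤ.- shift 0ℤ (d ⊕ vector s) (ℤ.+_ ∘ a u′) v) (recurrence v) ⟩
    ℤ.+ a u v ℤ.+ ℤ.+ shift 0 (vector s) (a u) v ℤ.+ ℤ.+ shift 0 (1⊕ s) (a u′) v ℤ.- shift 0ℤ (d ⊕ vector s) (ℤ.+_ ∘ a u′) v
      ≡⟨ cong₂ (λ x y → ℤ.+ a u v ℤ.+ x ℤ.+ y ℤ.- shift 0ℤ (d ⊕ vector s) (ℤ.+_ ∘ a u′) v)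
           (shift-map ℤ.+_ (vector s) v)
           (trans (shift-map ℤ.+_ (1⊕ s) v)
             (cong (λ z → shift 0ℤ (proj₂ s ∷ 1 ∷ z) (ℤ.+_ ∘ a u′) v) (sym (⊕-identityˡ _)))) ⟩
    ℤ.+ a u v ℤ.+ shift 0ℤ (vector s) (ℤ.+_ ∘ a u) v ℤ.+ shift 0ℤ (d ⊕ vector s) (ℤ.+_ ∘ a u′) v
      ℤ.- shift 0ℤ (d ⊕ vector s) (ℤ.+_ ∘ a u′) v
      ≡⟨ i+j-j≡i (ℤ.+ a u v ℤ.+ shift 0ℤ (vector s) (ℤ.+_ ∘ a u) v) _ ⟩
    ℤ.+ a u v ℤ.+ shift 0ℤ (vector s) (ℤ.+_ ∘ a u) v ∎
    where
    open ≡-Reasoning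
    1⊕ : Slot → Index r
    1⊕ s = overStat (partOf s false)
    s∉ : s ∉ sl
    s∉ s∈ = All.lookup s≢ s∈ refl
    recurrence : ∀ v → a u′ v ≡ a u v + shift 0 (vector s) (a u) v + shift 0 (1⊕ s) (a u′) v
    recurrence v = a-unique u′ (count-slot s∉ (a-count u v) (count-over s∉ λ b _ → a-count u b)
      (count-plain s∉ λ b _ → a-count u′ b))

  prod-aᵛ : ∀ {sl} (u : Unique sl) → prod D (map vector sl) (aᵛ u) ≈ prod E (map vector sl) I
  prod-aᵛ {[]}     u          = aᵛ-[] u
  prod-aᵛ {s ∷ sl} u@(_ ∷ u′) = begin
    D x (prod D xs (aᵛ u))  ≈⟨ prod-commute D-linear (λ y → D-commute y (D-linear x) (D-sh x)) xs (aᵛ u) ⟩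
    prod D xs (D x (aᵛ u))  ≈⟨ prod-linear D-linear xs .resp (aᵛ-∷ u′ u) ⟩
    prod D xs (E x (aᵛ u′)) ≈⟨ prod-commute D-linear (λ y → D-commute y (E-linear x) (E-sh x)) xs (aᵛ u′) ⟨
    E x (prod D xs (aᵛ u′)) ≈⟨ E-linear x .resp (prod-aᵛ u′) ⟩
    E x (prod E xs I)       ∎
    where
    open ≈-Reasoning
    x = vector s
    xs = map vector sl
    E-sh : ∀ x b → Commute (E x) (sh b)
    E-sh x b = commute-sym (sh b) (E x) (commute-⊞ (sh-linear b) commute-id (sh-sh b x))

  -- The slots of value at most M

  column : Fin r → ℕ → ℕ → List Slot
  column i m zero    = []
  column i m (suc c) = (i , m) ∷ column i (suc m) c

  grid : ∀ j → j ≤ r → List Slot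
  grid zero    _   = []
  grid (suc j) j<r = column (fromℕ< j<r) 0 (suc M) ++ grid j (ℕ.<⇒≤ j<r)

  map-column : ∀ i m c → map vector (column i m c) ≡ slotsFrom (toℕ i) m c
  map-column i m zero    = refl
  map-column i m (suc c) = cong (_ ∷_) (map-column i (suc m) c)

  map-grid : ∀ j j≤r → map vector (grid j j≤r) ≡ allSlots j
  map-grid zero    _   = refl
  map-grid (suc j) j<r = trans (List.map-++ vector (column (fromℕ< j<r) 0 (suc M)) (grid j (ℕ.<⇒≤ j<r)))
    (cong₂ _++_ (trans (map-column (fromℕ< j<r) 0 (suc M)) (cong (λ k → slotsFrom k 0 (suc M)) (Fin.toℕ-fromℕ< j<r)))
      (map-grid j _))

  ∈-column⁻ : ∀ {i m c s} → s ∈ column i m c → proj₁ s ≡ i × m ≤ proj₂ s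
  ∈-column⁻ {c = suc c} (here refl) = refl , ℕ.≤-refl
  ∈-column⁻ {c = suc c} (there s∈)  = let eq , lt = ∈-column⁻ s∈ in eq , ℕ.<⇒≤ lt

  ∈-column⁺ : ∀ {i m c m′} → m ≤ m′ → m′ < c + m → (i , m′) ∈ column i m c
  ∈-column⁺ {c = zero}  le lt = ⊥-elim (ℕ.<-irrefl refl (ℕ.<-≤-trans lt le))
  ∈-column⁺ {m = m} {suc c} {m′} le lt with ℕ.m≤n⇒m<n∨m≡n le
  ... | inj₂ refl = here refl
  ... | inj₁ lt′  = there (∈-column⁺ lt′ (subst (m′ <_) (sym (ℕ.+-suc c m)) lt))

  ∈-grid⁻ : ∀ {s} j j≤r → s ∈ grid j j≤r → toℕ (proj₁ s) < j
  ∈-grid⁻ (suc j) j<r s∈ with ∈-++⁻ (column (fromℕ< j<r) 0 (suc M)) s∈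
  ... | inj₁ s∈′ = s≤s (ℕ.≤-reflexive (trans (cong toℕ (proj₁ (∈-column⁻ s∈′))) (Fin.toℕ-fromℕ< j<r)))
  ... | inj₂ s∈′ = ℕ.m<n⇒m<1+n (∈-grid⁻ j _ s∈′)

  ∈-grid⁺ : ∀ {i m} j j≤r → toℕ i < j → m ≤ M → (i , m) ∈ grid j j≤r
  ∈-grid⁺ {i} {m} (suc j) j<r (s≤s i≤j) m≤M with ℕ.m≤n⇒m<n∨m≡n i≤j
  ... | inj₁ i<j  = ∈-++⁺ʳ (column (fromℕ< j<r) 0 (suc M)) (∈-grid⁺ j _ i<j m≤M)
  ... | inj₂ refl = ∈-++⁺ˡ (subst (λ k → (i , m) ∈ column k 0 (suc M)) (sym (Fin.fromℕ<-toℕ i j<r))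
                      (∈-column⁺ z≤n (s≤s (ℕ.≤-trans m≤M (ℕ.m≤m+n M 0)))))

  column-unique : ∀ i m c → Unique (column i m c)
  column-unique i m zero    = []
  column-unique i m (suc c) =
    All.tabulate (λ { s∈ refl → ℕ.<-irrefl refl (proj₂ (∈-column⁻ s∈)) }) ∷ column-unique i (suc m) c

  grid-unique : ∀ j j≤r → Unique (grid j j≤r)
  grid-unique zero    _   = []
  grid-unique (suc j) j<r = AllPairs.++⁺ (column-unique (fromℕ< j<r) 0 (suc M)) (grid-unique j _)
    (All.tabulate λ s∈ → All.tabulate λ { s∈′ refl → ℕ.<-irrefl
      (trans (cong toℕ (proj₁ (∈-column⁻ s∈))) (Fin.toℕ-fromℕ< j<r)) (∈-grid⁻ j _ s∈′) })

  total : V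
  total = aᵛ (grid-unique r ℕ.≤-refl)

  Den-total : Den total ≈ prod E (allSlots r) I
  Den-total = subst (λ xs → prod D xs total ≈ prod E xs I) (map-grid r ℕ.≤-refl) (prod-aᵛ (grid-unique r ℕ.≤-refl))

-- Colours as binary expansions

code : ∀ {r} → Subset⁺ r → ℕ
code sole     = 1
code (skip c) = code c * 2
code (join c) = 1 + code c * 2

1≤code : ∀ {r} (c : Subset⁺ r) → 1 ≤ code c
1≤code sole     = s≤s z≤n
1≤code (skip c) = ℕ.≤-trans (1≤code c) (ℕ.m≤m*n (code c) 2)
1≤code (join c) = s≤s z≤n

code<2^r : ∀ {r} (c : Subset⁺ r) → code c < 2 ^ r
code<2^r {suc r} sole     = ℕ.*-monoʳ-≤ 2 (ℕ.m^n>0 2 r)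
code<2^r {suc r} (skip c) = ℕ.<-≤-trans (ℕ.*-monoˡ-< 2 (code<2^r c)) (ℕ.≤-reflexive (ℕ.*-comm (2 ^ r) 2))
code<2^r {suc r} (join c) = ℕ.≤-trans (ℕ.*-monoˡ-≤ 2 (code<2^r c)) (ℕ.≤-reflexive (ℕ.*-comm (2 ^ r) 2))

-- The predecessor is taken because position c of `Colour r` stands for the index c + 1.
toColour : ∀ {r} → Subset⁺ r → Colour r
toColour {r} c = fromℕ< {pred (code c)} (ℕ.pred-mono-< {{>-nonZero (1≤code c)}} (code<2^r c))

index-toColour : ∀ {r} (c : Subset⁺ r) → index {r} (toColour c) ≡ code c
index-toColour c = trans (cong suc (Fin.toℕ-fromℕ< _)) (ℕ.suc-pred (code c) {{>-nonZero (1≤code c)}})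

bit-zero : ∀ i → bit 0 i ≡ i % 2
bit-zero i = cong (_% 2) (n/1≡n i)

bit-suc : ∀ j i → bit (suc j) i ≡ bit j (i / 2)
bit-suc j i = cong (_% 2) (sym (m/n/o≡m/[n*o] i 2 (2 ^ j) {{_}} {{ℕ.m^n≢0 2 j}} {{ℕ.m^n≢0 2 (suc j)}}))

bit-of-0 : ∀ j → bit j 0 ≡ 0
bit-of-0 j = cong (_% 2) (0/n≡0 (2 ^ j) {{ℕ.m^n≢0 2 j}})

bit-code : ∀ {r} (c : Subset⁺ r) j → bit (toℕ j) (code c) ≡ lookup (bits c) j
bit-code sole     Fin.zero    = refl
bit-code (skip c) Fin.zero    = trans (bit-zero (code c * 2)) (m*n%n≡0 (code c) 2)
bit-code (join c) Fin.zero    = trans (bit-zero (1 + code c * 2)) ([m+kn]%n≡m%n 1 (code c) 2)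
bit-code sole     (Fin.suc j) = trans (bit-suc (toℕ j) 1) (trans (bit-of-0 (toℕ j)) (sym (Vec.lookup-replicate j 0)))
bit-code (skip c) (Fin.suc j) = trans (bit-suc (toℕ j) (code c * 2))
  (trans (cong (bit (toℕ j)) (m*n/n≡m (code c) 2)) (bit-code c j))
bit-code (join c) (Fin.suc j) = trans (bit-suc (toℕ j) (1 + code c * 2))
  (trans (cong (bit (toℕ j))
    (trans (+-distrib-/-∣ʳ 1 {code c * 2} {2} (divides-refl (code c))) (m*n/n≡m (code c) 2))) (bit-code c j))

ε-toColour : ∀ {r} (c : Subset⁺ r) j → ε {r} j (toColour c) ≡ lookup (bits c) j
ε-toColour c j = trans (cong (bit (toℕ j)) (index-toColour c)) (bit-code c j)

bits≢zeros : ∀ {r} (c : Subset⁺ r) → bits c ≢ zeros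
bits≢zeros (skip c) eq = bits≢zeros c (Vec.∷-injectiveʳ eq)

bits-injective : ∀ {r} (c c′ : Subset⁺ r) → bits c ≡ bits c′ → c ≡ c′
bits-injective sole     sole      _  = refl
bits-injective sole     (join c′) eq = ⊥-elim (bits≢zeros c′ (sym (Vec.∷-injectiveʳ eq)))
bits-injective (skip c) (skip c′) eq = cong skip (bits-injective c c′ (Vec.∷-injectiveʳ eq))
bits-injective (join c) sole      eq = ⊥-elim (bits≢zeros c (Vec.∷-injectiveʳ eq))
bits-injective (join c) (join c′) eq = cong join (bits-injective c c′ (Vec.∷-injectiveʳ eq))

lookup-ext : ∀ {n} (xs ys : Vec ℕ n) → (∀ i → lookup xs i ≡ lookup ys i) → xs ≡ ys
lookup-ext []       []       _  = refl
lookup-ext (x ∷ xs) (y ∷ ys) eq = cong₂ _∷_ (eq Fin.zero) (lookup-ext xs ys (eq ∘ Fin.suc))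

toColour-injective : ∀ {r} (c c′ : Subset⁺ r) → toColour c ≡ toColour c′ → c ≡ c′
toColour-injective {r} c c′ eq = bits-injective c c′ (lookup-ext (bits c) (bits c′) λ j →
  trans (sym (ε-toColour c j)) (trans (cong (ε {r} j) eq) (ε-toColour c′ j)))

decode : ∀ r i → 1 ≤ i → i < 2 ^ r → Σ (Subset⁺ r) λ c → code c ≡ i
decode zero    (suc i) _   (s≤s ())
decode (suc r) i       1≤i i<  with i % 2 | i / 2 | m≡m%n+[m/n]*n i 2 | m%n<n i 2
                                  | m<n*o⇒m/o<n {i} {2 ^ r} {2} (subst (i <_) (ℕ.*-comm 2 (2 ^ r)) i<)
-- A zero quotient ends the expansion: remainder 1 is then `sole`, and remainder 0 would mean i = 0.
... | 0 | zero  | refl | _ | _  = ⊥-elim (ℕ.<-irrefl refl 1≤i)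
... | 1 | zero  | refl | _ | _  = sole , refl
... | 0 | suc h | refl | _ | h< = let c , eq = decode r (suc h) (s≤s z≤n) h< in skip c , cong (_* 2) eq
... | 1 | suc h | refl | _ | h< = let c , eq = decode r (suc h) (s≤s z≤n) h< in join c , cong (λ k → suc (k * 2)) eq
... | suc (suc _) | _ | _ | s≤s (s≤s ()) | _

toColour-surjective : ∀ {r} (c : Colour r) → ∃[ c′ ] toColour c′ ≡ c
toColour-surjective {r} c =
  let c′ , eq = decode r (index {r} c) (s≤s z≤n)
        (ℕ.<-≤-trans (s≤s (Fin.toℕ<n c)) (ℕ.≤-reflexive (ℕ.m+[n∸m]≡n (ℕ.m^n>0 2 r)))) in
  c′ , Fin.toℕ-injective (ℕ.suc-injective (trans (index-toColour c′) eq))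

-- Number, least and greatest of the primary colours

elements : ∀ {r} → Subset⁺ r → List (Fin r)
elements sole     = Fin.zero ∷ []
elements (skip c) = map Fin.suc (elements c)
elements (join c) = Fin.zero ∷ map Fin.suc (elements c)

filter-map : ∀ {A B : Set} {P : Pred B 0ℓ} (P? : Decidable P) (f : A → B) xs →
             filter P? (map f xs) ≡ map f (filter (P? ∘ f) xs)
filter-map P? f []       = refl
filter-map P? f (x ∷ xs) with P? (f x)
... | yes _ = cong (f x ∷_) (filter-map P? f xs)
... | no _  = filter-map P? f xs

filter-suc : ∀ {r} {P : Pred (Fin (suc r)) 0ℓ} (P? : Decidable P) →
             filter P? (List.tabulate Fin.suc) ≡ map Fin.suc (filter (P? ∘ Fin.suc) (allFin r))
filter-suc {r} P? = trans (cong (filter P?) (sym (List.map-tabulate id Fin.suc))) (filter-map P? Fin.suc (allFin r))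

filter-bits : ∀ {r} (c : Subset⁺ r) → filter (λ j → lookup (bits c) j ℕ.≟ 1) (allFin r) ≡ elements c
filter-bits {suc r} sole = cong (Fin.zero ∷_) (List.filter-none _
  (All.tabulate⁺ {f = Fin.suc} λ j eq → ℕ.0≢1+n (trans (sym (Vec.lookup-replicate j 0)) eq)))
filter-bits {suc r} (skip c) =
  trans (filter-suc (λ j → lookup (bits (skip c)) j ℕ.≟ 1)) (cong (map Fin.suc) (filter-bits c))
filter-bits {suc r} (join c) = cong (Fin.zero ∷_)
  (trans (filter-suc (λ j → lookup (bits (join c)) j ℕ.≟ 1)) (cong (map Fin.suc) (filter-bits c)))

primaries-toColour : ∀ {r} (c : Subset⁺ r) → primaries {r} (toColour c) ≡ elements c
primaries-toColour {r} c = trans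
  (List.filter-≐ (isPrimaryOf? {r} (toColour c)) (λ j → lookup (bits c) j ℕ.≟ 1)
    ((λ {j} eq → trans (sym (ε-toColour c j)) eq) , (λ {j} eq → trans (ε-toColour c j) eq)) (allFin r))
  (filter-bits c)

length-elements : ∀ {r} (c : Subset⁺ r) → length (elements c) ≡ card c
length-elements sole     = refl
length-elements (skip c) = trans (List.length-map Fin.suc (elements c)) (length-elements c)
length-elements (join c) = cong suc (trans (List.length-map Fin.suc (elements c)) (length-elements c))

w-toColour : ∀ {r} (c : Subset⁺ r) → w {r} (toColour c) ≡ card c
w-toColour c = trans (cong length (primaries-toColour c)) (length-elements c)

leastᶠ greatestᶠ : ∀ {r} → Subset⁺ r → Fin r
leastᶠ sole     = Fin.zero
leastᶠ (skip c) = Fin.suc (leastᶠ c)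
leastᶠ (join c) = Fin.zero
greatestᶠ sole     = Fin.zero
greatestᶠ (skip c) = Fin.suc (greatestᶠ c)
greatestᶠ (join c) = Fin.suc (greatestᶠ c)

toℕ-leastᶠ : ∀ {r} (c : Subset⁺ r) → toℕ (leastᶠ c) ≡ least c
toℕ-leastᶠ sole     = refl
toℕ-leastᶠ (skip c) = cong suc (toℕ-leastᶠ c)
toℕ-leastᶠ (join c) = refl

toℕ-greatestᶠ : ∀ {r} (c : Subset⁺ r) → toℕ (greatestᶠ c) ≡ greatest c
toℕ-greatestᶠ sole     = refl
toℕ-greatestᶠ (skip c) = cong suc (toℕ-greatestᶠ c)
toℕ-greatestᶠ (join c) = cong suc (toℕ-greatestᶠ c)

leastᶠ∈ : ∀ {r} (c : Subset⁺ r) → leastᶠ c ∈ elements c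
leastᶠ∈ sole     = here refl
leastᶠ∈ (skip c) = ∈-map⁺ Fin.suc (leastᶠ∈ c)
leastᶠ∈ (join c) = here refl

greatestᶠ∈ : ∀ {r} (c : Subset⁺ r) → greatestᶠ c ∈ elements c
greatestᶠ∈ sole     = here refl
greatestᶠ∈ (skip c) = ∈-map⁺ Fin.suc (greatestᶠ∈ c)
greatestᶠ∈ (join c) = there (∈-map⁺ Fin.suc (greatestᶠ∈ c))

leastᶠ≤ : ∀ {r} (c : Subset⁺ r) → All (leastᶠ c Fin.≤_) (elements c)
leastᶠ≤ sole     = z≤n ∷ []
leastᶠ≤ (skip c) = All.map⁺ (All.map s≤s (leastᶠ≤ c))
leastᶠ≤ (join c) = All.universal (λ _ → z≤n) _

≤greatestᶠ : ∀ {r} (c : Subset⁺ r) → All (Fin._≤ greatestᶠ c) (elements c)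
≤greatestᶠ sole     = z≤n ∷ []
≤greatestᶠ (skip c) = All.map⁺ (All.map s≤s (≤greatestᶠ c))
≤greatestᶠ (join c) = z≤n ∷ All.map⁺ (All.map s≤s (≤greatestᶠ c))

v-toColour : ∀ {r} (c : Subset⁺ r) → toℕ (v {r} (toColour c)) ≡ least c
v-toColour {suc r} c = trans (cong toℕ (trans
    (cong (Extrema.min (Fin.≤-totalOrder (suc r)) (fromℕ r)) (primaries-toColour c))
    (Extrema.min≈v⁺ (Fin.≤-totalOrder (suc r)) (leastᶠ∈ c) (leastᶠ≤ c) (Fin.≤fromℕ (leastᶠ c)))))
  (toℕ-leastᶠ c)

z-toColour : ∀ {r} (c : Subset⁺ r) → toℕ (z {r} (toColour c)) ≡ greatest c
z-toColour {suc r} c = trans (cong toℕ (trans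
    (cong (Extrema.max (Fin.≤-totalOrder (suc r)) Fin.zero) (primaries-toColour c))
    (Extrema.max≈v⁺ (Fin.≤-totalOrder (suc r)) (greatestᶠ∈ c) (≤greatestᶠ c) z≤n)))
  (toℕ-greatestᶠ c)

indicator : ∀ {P : Set} (P? : Dec P) {k} → (P → k ≡ 1) → (¬ P → k ≡ 0) → (if does P? then 1 else 0) ≡ k
indicator (yes p) k≡1 _ = sym (k≡1 p)
indicator (no ¬p) _ k≡0 = sym (k≡0 ¬p)

-- The strict inequality z < v is z + 1 ≤ v, whence the index z + 1 for the tail in `Bounded`.
δ-toColour : ∀ {r} (c c′ : Subset⁺ r) → δ {r} (toColour c) (toColour c′) ≡ [ suc (greatest c) ≤ least c′ ]
δ-toColour {r} c c′ = indicator (z {r} (toColour c) Fin.<? v {r} (toColour c′))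
  (λ lt → [≤]-yes (subst (λ k → suc k ≤ least c′) (z-toColour c) (subst (_ <_) (v-toColour c′) lt)))
  (λ ¬lt → [≤]-no (s≤s (ℕ.≮⇒≥ λ lt → ¬lt
    (subst (_< _) (sym (z-toColour c)) (subst (_ <_) (sym (v-toColour c′)) lt)))))

-- The two sides in terms of exponent vectors

count-∷ : {A : Set} {P : Pred A 0ℓ} (P? : Decidable P) (x : A) (xs : List A) →
          count P? (x ∷ xs) ≡ (if does (P? x) then 1 else 0) + count P? xs
count-∷ P? x xs with does (P? x)
... | true  = refl
... | false = refl

target : ∀ {r} → (Fin r → ℕ) → ℕ → ℕ → Index r
target ℓ k n = n ∷ k ∷ tabulate ℓ

target-cong : ∀ {r} {ℓ ℓ′ : Fin r → ℕ} {k k′ n n′} → n ≡ n′ → k ≡ k′ → (∀ i → ℓ i ≡ ℓ′ i) → target ℓ k n ≡ target ℓ′ k′ n′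
target-cong refl refl eq = cong (λ t → _ ∷ _ ∷ t) (Vec.tabulate-cong eq)

target-injective : ∀ {r} {ℓ ℓ′ : Fin r → ℕ} {k k′ n n′} → target ℓ k n ≡ target ℓ′ k′ n′ →
                   n ≡ n′ × k ≡ k′ × (∀ i → ℓ i ≡ ℓ′ i)
target-injective {ℓ = ℓ} {ℓ′} eq =
  Vec.∷-injectiveˡ eq , Vec.∷-injectiveˡ (Vec.∷-injectiveʳ eq) ,
  λ i → trans (sym (Vec.lookup∘tabulate ℓ i)) (trans (cong (λ t → lookup t i) (Vec.∷-injectiveʳ (Vec.∷-injectiveʳ eq)))
    (Vec.lookup∘tabulate ℓ′ i))

⊕-tabulate : ∀ {r} (a : Vec ℕ r) (g : Fin r → ℕ) → a ⊕ tabulate g ≡ tabulate (λ i → lookup a i + g i)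
⊕-tabulate a g = lookup-ext _ _ λ i → trans (Vec.lookup-zipWith _+_ i a (tabulate g))
  (trans (cong (lookup a i +_) (Vec.lookup∘tabulate g i)) (sym (Vec.lookup∘tabulate (λ i → lookup a i + g i) i)))

zeros≡tabulate : ∀ r → zeros ≡ tabulate {n = r} (λ _ → 0)
zeros≡tabulate r = lookup-ext _ _ λ i → trans (Vec.lookup-replicate i 0) (sym (Vec.lookup∘tabulate (λ _ → 0) i))

nonOverlined-∷ : {C : Set} (p : Part C) (ps : List (Part C)) →
                 #nonOverlined (p ∷ ps) ≡ (if overlined p then 0 else 1) + #nonOverlined ps
nonOverlined-∷ (part _ _ true)  ps = refl
nonOverlined-∷ (part _ _ false) ps = refl

lookup-unit : ∀ {r} (c i : Fin r) → (c ≡ i → lookup (unit r (toℕ c)) i ≡ 1) × (c ≢ i → lookup (unit r (toℕ c)) i ≡ 0)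
lookup-unit Fin.zero    Fin.zero    = (λ _ → refl) , λ c≢i → ⊥-elim (c≢i refl)
lookup-unit Fin.zero    (Fin.suc i) = (λ ()) , λ _ → Vec.lookup-replicate i 0
lookup-unit (Fin.suc c) Fin.zero    = (λ ()) , λ _ → refl
lookup-unit (Fin.suc c) (Fin.suc i) =
  (λ { refl → proj₁ (lookup-unit c c) refl }) , λ c≢i → proj₂ (lookup-unit c i) (c≢i ∘ cong Fin.suc)

lookup-bits : ∀ {r} (c : Subset⁺ r) i → lookup (bits c) i ≢ 1 → lookup (bits c) i ≡ 0
lookup-bits sole     Fin.zero    ≢1 = ⊥-elim (≢1 refl)
lookup-bits (skip c) Fin.zero    ≢1 = refl
lookup-bits (join c) Fin.zero    ≢1 = ⊥-elim (≢1 refl)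
lookup-bits sole     (Fin.suc i) ≢1 = Vec.lookup-replicate i 0
lookup-bits (skip c) (Fin.suc i) ≢1 = lookup-bits c i ≢1
lookup-bits (join c) (Fin.suc i) ≢1 = lookup-bits c i ≢1

card≤r : ∀ {r} (c : Subset⁺ r) → card c ≤ r
card≤r sole     = s≤s z≤n
card≤r (skip c) = ℕ.m≤n⇒m≤1+n (card≤r c)
card≤r (join c) = s≤s (card≤r c)

private
  lhs : ∀ a w x y → a ℤ.+ 1ℤ ℤ.+ (w ℤ.+ x ℤ.- 1ℤ ℤ.+ y) ≡ a ℤ.+ w ℤ.+ x ℤ.+ y
  lhs = solve-∀
  rhs : ∀ a b → a ℤ.+ 1ℤ ℤ.+ (b ℤ.- a) ≡ 1ℤ ℤ.+ b
  rhs = solve-∀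
  undo : ∀ a b → ℤ.- a ℤ.+ (a ℤ.+ b) ≡ b
  undo = solve-∀

-- Adding a + 1 to both sides clears both subtractions of the gap condition; its -1 becomes the
-- successor in `Bounded`.
difference⇒sum : ∀ b a w x y → ℤ.+ w ℤ.+ ℤ.+ x ℤ.- 1ℤ ℤ.+ ℤ.+ y ℤ.≤ ℤ.+ b ℤ.- ℤ.+ a → a + w + x + y ≤ suc b
difference⇒sum b a w x y le = ℤ.drop‿+≤+ (subst₂ ℤ._≤_ (lhs (ℤ.+ a) (ℤ.+ w) (ℤ.+ x) (ℤ.+ y)) (rhs (ℤ.+ a) (ℤ.+ b))
  (ℤ.+-monoʳ-≤ (ℤ.+ a ℤ.+ 1ℤ) le))

sum⇒difference : ∀ b a w x y → a + w + x + y ≤ suc b → ℤ.+ w ℤ.+ ℤ.+ x ℤ.- 1ℤ ℤ.+ ℤ.+ y ℤ.≤ ℤ.+ b ℤ.- ℤ.+ a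
sum⇒difference b a w x y le = subst₂ ℤ._≤_ (undo (ℤ.+ a ℤ.+ 1ℤ) _) (undo (ℤ.+ a ℤ.+ 1ℤ) _)
  (ℤ.+-monoʳ-≤ (ℤ.- (ℤ.+ a ℤ.+ 1ℤ))
    (subst₂ ℤ._≤_ (sym (lhs (ℤ.+ a) (ℤ.+ w) (ℤ.+ x) (ℤ.+ y))) (sym (rhs (ℤ.+ a) (ℤ.+ b))) (ℤ.+≤+ le)))

-- From the sets of the statement to the sets counted above

module Translate (r M : ℕ) where
  open Operators r M
  open Sequences r M
  open Overpartitions r M

  private
    combine : ∀ {C : Set} {p : Part C} {ps : List (Part C)} {t} {ℓ ℓ′ : Fin r → ℕ} →
              (∀ i → lookup t i + ℓ i ≡ ℓ′ i) →
              (value p ∷ (if overlined p then 0 else 1) ∷ t) ⊕ target ℓ (#nonOverlined ps) (weight ps)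
                ≡ target ℓ′ (#nonOverlined (p ∷ ps)) (weight (p ∷ ps))
    combine {p = p} {ps} {t} {ℓ} eq = cong₂ (λ x y → weight (p ∷ ps) ∷ x ∷ y) (sym (nonOverlined-∷ p ps))
      (trans (⊕-tabulate t ℓ) (Vec.tabulate-cong eq))

  multiStat≡target : ∀ ps → multiStat ps ≡ target (λ i → count (λ p → colour p Fin.≟ i) ps) (#nonOverlined ps) (weight ps)
  multiStat≡target []       = cong (λ t → 0 ∷ 0 ∷ t) (zeros≡tabulate r)
  multiStat≡target (p ∷ ps) = trans (cong (overStat p ⊕_) (multiStat≡target ps)) (combine {p = p} {ps} λ i →
    sym (trans (count-∷ (λ p → colour p Fin.≟ i) p ps) (cong (_+ count (λ p → colour p Fin.≟ i) ps)
      (indicator (colour p Fin.≟ i) (proj₁ (lookup-unit (colour p) i)) (proj₂ (lookup-unit (colour p) i))))))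

  recolour : Part (Subset⁺ r) → Part (Colour r)
  recolour p = part (value p) (toColour (colour p)) (overlined p)

  stat≡target : ∀ ps → stat ps ≡ target (λ i → count (λ p → isPrimaryOf? {r} (colour p) i) (map recolour ps))
                                        (#nonOverlined (map recolour ps)) (weight (map recolour ps))
  stat≡target []       = cong (λ t → 0 ∷ 0 ∷ t) (zeros≡tabulate r)
  stat≡target (p ∷ ps) = trans (cong (partStat p ⊕_) (stat≡target ps))
    (combine {p = recolour p} {map recolour ps} λ i →
      sym (trans (count-∷ (λ p → isPrimaryOf? {r} (colour p) i) (recolour p) (map recolour ps))
        (cong (_+ count (λ p → isPrimaryOf? {r} (colour p) i) (map recolour ps))
          (indicator (isPrimaryOf? {r} (toColour (colour p)) i)
            (λ eq → trans (sym (ε-toColour (colour p) i)) eq)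
            (λ ≢1 → lookup-bits (colour p) i (≢1 ∘ trans (ε-toColour (colour p) i)))))))

  value≤weight : ∀ {C : Set} (ps : List (Part C)) → All (λ p → value p ≤ weight ps) ps
  value≤weight []       = []
  value≤weight (p ∷ ps) = ℕ.m≤m+n _ _ ∷ All.map (λ le → ℕ.≤-trans le (ℕ.m≤n+m _ _)) (value≤weight ps)

  -- No part exceeds the sum n, so the grid of values up to M contains every slot in use.
  inA⇒inO : ∀ {ℓ k n ps} → n ≤ M → InA r ℓ k n ps → InO (grid r ℕ.≤-refl) (target ℓ k n) ps
  inA⇒inO {ps = ps} n≤M record { overpartition = o ; total = refl ; colours = cs ; nonOverlined = refl } =
    All.map (λ {p} le → ∈-grid⁺ r ℕ.≤-refl (Fin.toℕ<n (colour p)) (ℕ.≤-trans le n≤M)) (value≤weight ps) , o ,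
    trans (multiStat≡target ps) (target-cong refl refl cs)

  inO⇒inA : ∀ {ℓ k n ps sl} → InO sl (target ℓ k n) ps → InA r ℓ k n ps
  inO⇒inA {ps = ps} (_ , o , st) =
    let n≡ , k≡ , ℓ≡ = target-injective (trans (sym (multiStat≡target ps)) st) in
    record { overpartition = o ; total = n≡ ; colours = ℓ≡ ; nonOverlined = k≡ }

  NatGap : Part (Subset⁺ r) → Part (Subset⁺ r) → Set
  NatGap p p′ = footprint p′ + [ suc (greatest (colour p)) ≤ least (colour p′) ] ≤ suc (value p)

  footprint-recolour : ∀ p p′ →
    value p′ + w {r} (toColour (colour p′)) + χ p′ + δ {r} (toColour (colour p)) (toColour (colour p′))
      ≡ footprint p′ + [ suc (greatest (colour p)) ≤ least (colour p′) ]
  footprint-recolour p p′ =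
    cong₂ (λ x y → value p′ + x + χ p′ + y) (w-toColour (colour p′)) (δ-toColour (colour p) (colour p′))

  gap⇒natGap : ∀ p p′ → Gap {r} (recolour p) (recolour p′) → NatGap p p′
  gap⇒natGap p p′ g = subst (_≤ suc (value p)) (footprint-recolour p p′)
    (difference⇒sum (value p) (value p′) (w {r} (toColour (colour p′))) (χ p′) _ g)

  natGap⇒gap : ∀ p p′ → NatGap p p′ → Gap {r} (recolour p) (recolour p′)
  natGap⇒gap p p′ le =
    sum⇒difference (value p) (value p′) (w {r} (toColour (colour p′))) (χ p′) _
      (subst (_≤ suc (value p)) (sym (footprint-recolour p p′)) le)

  linked⇒bounded : ∀ p ps → Linked (Gap {r}) (map recolour (p ∷ ps)) → Bounded (suc (greatest (colour p))) (value p) ps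
  linked⇒bounded p []        _       = tt
  linked⇒bounded p (p′ ∷ ps) (g ∷ l) = gap⇒natGap p p′ g , linked⇒bounded p′ ps l

  bounded⇒linked : ∀ p ps → Bounded (suc (greatest (colour p))) (value p) ps → Linked (Gap {r}) (map recolour (p ∷ ps))
  bounded⇒linked p []        _       = [-]
  bounded⇒linked p (p′ ∷ ps) (g , b) = natGap⇒gap p p′ g ∷ bounded⇒linked p′ ps b

  χ≤1 : ∀ {C : Set} (p : Part C) → χ p ≤ 1
  χ≤1 (part _ _ true)  = s≤s z≤n
  χ≤1 (part _ _ false) = z≤n

  -- Origin of n + r: a first part has value at most n, at most r primary colours and χ at most 1,
  -- so its footprint is at most n + r + 1 and the bound holds for every N from n + r on.
  inB⇒inF : ∀ {ℓ k n N} ps → n + r ≤ N → InB r ℓ k n (map recolour ps) → InF r N (target ℓ k n) ps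
  inB⇒inF {ℓ} {k} {n} {N} ps le record { total = refl ; colours = cs ; nonOverlined = refl ; gaps = l } =
    bounded ps le l , trans (stat≡target ps) (target-cong refl refl cs)
    where
    bounded : ∀ ps → weight (map recolour ps) + r ≤ N → Linked (Gap {r}) (map recolour ps) → Bounded r N ps
    bounded []       _  _ = tt
    bounded (p ∷ ps) le l = (begin
      value p + card (colour p) + χ p + [ r ≤ least (colour p) ]
        ≡⟨ trans (cong (footprint p +_) ([≤]-no (least<r (colour p)))) (ℕ.+-identityʳ _) ⟩
      value p + card (colour p) + χ p
        ≤⟨ ℕ.+-mono-≤ (ℕ.+-mono-≤ (ℕ.m≤m+n (value p) _) (card≤r (colour p))) (χ≤1 p) ⟩
      weight (map recolour (p ∷ ps)) + r + 1
        ≤⟨ ℕ.+-monoˡ-≤ 1 le ⟩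
      N + 1
        ≡⟨ ℕ.+-comm N 1 ⟩
      suc N ∎) , linked⇒bounded p ps l
      where open ℕ.≤-Reasoning

  inF⇒inB : ∀ {ℓ k n N} ps → InF r N (target ℓ k n) ps → InB r ℓ k n (map recolour ps)
  inF⇒inB {ℓ} {k} {n} {N} ps (b , st) =
    let n≡ , k≡ , ℓ≡ = target-injective (trans (sym (stat≡target ps)) st) in
    record { total = n≡ ; colours = ℓ≡ ; nonOverlined = k≡ ; gaps = linked ps b }
    where
    linked : ∀ ps → Bounded r N ps → Linked (Gap {r}) (map recolour ps)
    linked []       _       = []
    linked (p ∷ ps) (_ , b) = bounded⇒linked p ps b

  recolour-injective : ∀ {p p′} → recolour p ≡ recolour p′ → p ≡ p′
  recolour-injective {p} {p′} eq = lemma (cong value eq) (toColour-injective _ _ (cong colour eq)) (cong overlined eq)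
    where
    lemma : value p ≡ value p′ → colour p ≡ colour p′ → overlined p ≡ overlined p′ → p ≡ p′
    lemma refl refl refl = refl

  recolour-surjective : ∀ ps → ∃[ qs ] ps ≡ map recolour qs
  recolour-surjective []       = [] , refl
  recolour-surjective (p ∷ ps) =
    let c , eq = toColour-surjective {r} (colour p)
        qs , eqs = recolour-surjective ps
    in part (value p) c (overlined p) ∷ qs , cong₂ _∷_ (cong (λ c → part (value p) c (overlined p)) (sym eq)) eqs

  count-A : ∀ ℓ k n → n ≤ M → Count (↭-setoid {A = Part (Fin r)}) (InA r ℓ k n) (a (grid-unique r ℕ.≤-refl) (target ℓ k n))
  count-A ℓ k n n≤M = count-resp ↭-setoid inO⇒inA (inA⇒inO n≤M) (a-count (grid-unique r ℕ.≤-refl) (target ℓ k n))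

  count-B : ∀ ℓ k n N → n + r ≤ N → Count (setoid (List (Part (Colour r)))) (InB r ℓ k n) (f r N (target ℓ k n))
  count-B ℓ k n N le = count-map (setoid Seq) (setoid _) (map recolour) (cong (map recolour))
    (λ _ _ → List.map-injective recolour-injective) (λ {ps} → inF⇒inB ps)
    (λ {ps} ib → let qs , eq = recolour-surjective ps in
       qs , inB⇒inF qs le (subst (InB r ℓ k n) eq ib) , eq)
    (f-count r N (target ℓ k n))

theorem2p7 : (r : ℕ) → 1 ≤ r → (ℓ : Primary r → ℕ) (k n : ℕ) →
    ∃[ N ] ((Ā r ℓ k n HasCardinality N) × (B̄ r ℓ k n HasCardinality N))
theorem2p7 r _ ℓ k n =
  _ , cardinality ↭-setoid (count-A ℓ k n ℕ.≤-refl) ,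
  cardinality (setoid _) (subst (Count (setoid _) (InB r ℓ k n)) f≡a (count-B ℓ k n N (ℕ.m≤n+m (n + r) (from limit))))
  where
  -- Working modulo q^(n+1) is enough, since only a coefficient of q^n is read off.
  open Operators r n
  open Sequences r n
  open Overpartitions r n
  open Translate r n
  limit : G r ~ total
  limit = solution-limit G-solves Den-total
  -- Large enough both for the limit to be attained and, through n + r, for the bound on the first
  -- part to hold automatically.
  N = from limit + (n + r)
  f≡a : f r N (target ℓ k n) ≡ a (grid-unique r ℕ.≤-refl) (target ℓ k n)
  f≡a = ℤ.+-injective (agrees limit N (target ℓ k n) (ℕ.m≤m+n (from limit) (n + r)) ℕ.≤-refl)
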